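{- Let $S=R\cup B$ be a finite nonempty set of points in general position in the plane, colored with two colors, where $R$ is the set of red points and $B$ is the set of blue points ($R\cap B=\emptyset$). Let $r=|R|$, $b=|B|$, and let $D_2=\max_{I\in\mathcal{I}_2}\operatorname{disc}(I)$ be the maximum discrepancy of a $2$-separable island of $S$. Then $$\max\left\{\frac{\mathcal{C}(S)}{128},\ \frac{\mathcal{C}(S)}{64}-|r-b|\right\}\ \le\ \max\left\{\frac{D_2}{8},\ \frac{D_2}{4}-|r-b|\right\}\ \le\ \mathcal{C}(S).$$
   Context: General position means that no three points of $S$ are collinear. For $Y\subseteq S$, the discrepancy of $Y$ is $\operatorname{disc}(Y)=\bigl||Y\cap R|-|Y\cap B|\bigr|$. An island of $S$ is a subset $I\subseteq S$ such that $I=C\cap S$ for some convex set $C\subseteq\mathbb{R}^2$. For a positive integer $k$, an island $I$ is $k$-separable if there are halfplanes $H_1,\dots,H_t$ with $1\le t\le k$ such that $I=S\cap(H_1\cap\dots\cap H_t)$; $\mathcal{I}_k$ denotes the family of all $k$-separable islands of $S$. A convex partition of $S$ is a partition $\Pi=\{S_1,\dots,S_m\}$ of $S$ into (nonempty) islands with pairwise disjoint convex hulls; its discrepancy is $\operatorname{disc}(\Pi)=\min_{1\le i\le m}\operatorname{disc}(S_i)$. The coarseness of the colored set $S$ is $\mathcal{C}(S)=\max_{\Pi}\operatorname{disc}(\Pi)$, the maximum over all convex partitions $\Pi$ of $S$. -}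

module Defs where

open import Algebra.Apartness.Bundles using (HeytingCommutativeRing; HeytingField)
open import Algebra.Bundles using (CommutativeRing)
import Algebra.Properties.CommutativeMonoid.Sum as Summation
import Algebra.Properties.Monoid.Mult as Multiple
open import Data.Fin.Base using (Fin)
open import Data.Fin.Subset using (Subset; _∈_; _∉_; _∩_; _∪_; ⊤; ⊥; ∣_∣; Nonempty; Empty)
open import Data.Integer.Base using (+_)
open import Data.Nat.Base as ℕ using (ℕ; suc)
open import Data.Product.Base using (∃-syntax; Σ-syntax; _×_; _,_; proj₁; proj₂)
open import Data.Rational.Base using (ℚ; _/_)
open import Data.Sum.Base using (_⊎_)
open import Data.Vec.Base using (Vec; lookup; map; foldr₁)
open import Function.Bundles using (_⇔_)
open import Function.Definitions using (Injective)
open import Level using (0ℓ) renaming (suc to lsuc)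
open import Relation.Binary.Core using (Rel)
open import Relation.Binary.Definitions using (_Respects_)
open import Relation.Binary.PropositionalEquality.Core using (_≡_; _≢_)
open import Relation.Binary.Structures using (IsStrictPartialOrder)
open import Relation.Nullary.Negation.Core using (¬_)
open import Relation.Unary using (Pred)

-- The real numbers, axiomatised as a Cauchy-complete Archimedean ordered
-- field.  Classically these axioms determine ℝ up to isomorphism.  The order
-- is not assumed decidable, so that the constructive reals (for instance
-- regular Cauchy sequences of rationals with the usual setoid equality) are
-- a model.
record RealNumbers : Set₁ where
  infix 4 _<_ _≤_ _≥_

  field
    heytingField : HeytingField 0ℓ 0ℓ 0ℓ

  open HeytingField heytingField public
    using (_≈_; _#_; _+_; _*_; 0#; 1#; heytingCommutativeRing)
    renaming (Carrier to ℝ)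

  open HeytingCommutativeRing heytingCommutativeRing public
    using (commutativeRing)

  open CommutativeRing commutativeRing public
    using (+-monoid; +-commutativeMonoid)

  open Multiple +-monoid public using () renaming (_×_ to _·_)
  open Summation +-commutativeMonoid public using (sum)

  field
    _<_                  : Rel ℝ 0ℓ
    isStrictPartialOrder : IsStrictPartialOrder _≈_ _<_
    #⇔<⊎>                : ∀ {x y} → x # y ⇔ (x < y ⊎ y < x)
    +-monoˡ-<            : ∀ {x y} z → x < y → x + z < y + z
    *-pos                : ∀ {x y} → 0# < x → 0# < y → 0# < x * y
    archimedean          : ∀ x → ∃[ n ] x < n · 1#

  _≤_ : Rel ℝ 0ℓ
  x ≤ y = ¬ (y < x)

  _≥_ : Rel ℝ 0ℓ
  x ≥ y = y ≤ x

  Close : ℝ → Rel ℝ 0ℓ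
  Close ε x y = x < y + ε × y < x + ε

  Cauchy : (ℕ → ℝ) → Set
  Cauchy s = ∀ ε → 0# < ε →
    ∃[ N ] (∀ i j → i ℕ.≥ N → j ℕ.≥ N → Close ε (s i) (s j))

  _ConvergesTo_ : (ℕ → ℝ) → ℝ → Set
  s ConvergesTo l = ∀ ε → 0# < ε →
    ∃[ N ] (∀ i → i ℕ.≥ N → Close ε (s i) l)

  field
    complete : ∀ s → Cauchy s → ∃[ l ] s ConvergesTo l

_IsMaximumOf_ : ∀ {a} {A : Set a} → ℕ → (A → ℕ) → Set a
v IsMaximumOf f = (∃[ x ] f x ≡ v) × (∀ x → f x ℕ.≤ v)

module Plane (𝓡 : RealNumbers) where
  open RealNumbers 𝓡

  Point : Set
  Point = ℝ × ℝ

  infix 4 _≈ₚ_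

  _≈ₚ_ : Rel Point 0ℓ
  (x , y) ≈ₚ (x′ , y′) = x ≈ x′ × y ≈ y′

  -- Coefficients of a x + b y = c, respectively a x + b y ≤ c.
  record Coefficients : Set where
    field
      a b c         : ℝ
      nondegenerate : a # 0# ⊎ b # 0#

  Line HalfPlane : Coefficients → Pred Point 0ℓ
  Line      l (x , y) = let open Coefficients l in a * x + b * y ≈ c
  HalfPlane h (x , y) = let open Coefficients h in a * x + b * y ≤ c

  Collinear : Point → Point → Point → Set
  Collinear p q r = ∃[ l ] Line l p × Line l q × Line l r

  combination : ℝ → Point → ℝ → Point → Point
  combination s (x , y) t (x′ , y′) = s * x + t * x′ , s * y + t * y′

  record IsConvex (C : Pred Point 0ℓ) : Set where
    field
      respects-≈ : C Respects _≈ₚ_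
      convex     : ∀ {p q} → C p → C q →
                   ∀ {s t} → s ≥ 0# → t ≥ 0# → s + t ≈ 1# →
                   C (combination s p t q)

  -- A set of n points of the plane is enumerated injectively by Fin n, and its
  -- subsets are represented by sets of indices.
  record ColouredPointSet (n : ℕ) : Set where
    field
      point     : Fin n → Point
      injective : Injective _≡_ _≈ₚ_ point
      R B       : Subset n
      R∪B≡S     : R ∪ B ≡ ⊤
      R∩B≡∅     : R ∩ B ≡ ⊥

  module _ {n : ℕ} (S : ColouredPointSet n) where
    open ColouredPointSet S

    GeneralPosition : Set
    GeneralPosition = ∀ {i j k} → i ≢ j → i ≢ k → j ≢ k →
      ¬ Collinear (point i) (point j) (point k)

    disc : Subset n → ℕ
    disc Y = ℕ.∣ ∣ Y ∩ R ∣ - ∣ Y ∩ B ∣ ∣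

    _CutOutBy_ : Subset n → Pred Point 0ℓ → Set
    I CutOutBy C = ∀ i → i ∈ I ⇔ C (point i)

    Island : Pred (Subset n) (lsuc 0ℓ)
    Island I = Σ[ C ∈ Pred Point 0ℓ ] IsConvex C × I CutOutBy C

    Separable : ℕ → Pred (Subset n) 0ℓ
    Separable k I = ∃[ t ] 1 ℕ.≤ t × t ℕ.≤ k ×
      (Σ[ H ∈ (Fin t → Coefficients) ] I CutOutBy (λ p → ∀ (j : Fin t) → HalfPlane (H j) p))

    SeparableIsland : ℕ → Set₁
    SeparableIsland k = ∃[ I ] Island I × Separable k I

    ConvexHull : Subset n → Pred Point 0ℓ
    ConvexHull Y p = Σ[ w ∈ (Fin n → ℝ) ]
      (∀ i → w i ≥ 0#) × (∀ i → i ∉ Y → w i ≈ 0#) × sum w ≈ 1# ×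
      p ≈ₚ ( sum (λ i → w i * proj₁ (point i))
           , sum (λ i → w i * proj₂ (point i)))

    -- The number of parts is suc m, since the set partitioned is nonempty.
    record ConvexPartition : Set₁ where
      field
        {m}            : ℕ
        parts          : Vec (Subset n) (suc m)
        nonempty       : ∀ k → Nonempty (lookup parts k)
        covering       : ∀ i → ∃[ k ] i ∈ lookup parts k
        disjoint       : ∀ {k l} → k ≢ l → Empty (lookup parts k ∩ lookup parts l)
        islands        : ∀ k → Island (lookup parts k)
        hulls-disjoint : ∀ {k l} → k ≢ l → ∀ p →
          ¬ (ConvexHull (lookup parts k) p × ConvexHull (lookup parts l) p)

    discΠ : ConvexPartition → ℕ
    discΠ Π = foldr₁ ℕ._⊓_ (map disc (ConvexPartition.parts Π))

    -- Maxima are specified relationally: convexity of a partition and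
    -- separability of a subset are not decidable for constructive reals.
    IsCoarseness : ℕ → Set₁
    IsCoarseness c = c IsMaximumOf discΠ

    IsMaxSeparableDisc : ℕ → ℕ → Set₁
    IsMaxSeparableDisc k d =
      d IsMaximumOf (λ (I : SeparableIsland k) → disc (proj₁ I))

    imbalance : ℚ
    imbalance = + ℕ.∣ ∣ R ∣ - ∣ B ∣ ∣ / 1

{-# OPTIONS --safe #-}
module Submission where

-- Red points have weight 1 and blue points weight -1, so that the discrepancy
-- of a set is the absolute value of its weight.  Both bounds compare natural
-- numbers, hence are decidable, and may be proved under a double negation,
-- which makes finitely many comparisons of reals available.
--
-- Second inequality.  Let I = S ∩ H₁ ∩ H₂ have discrepancy d₂.  The lines of
-- H₁ and H₂ give convex partitions of S into the two sides of H₁, into the two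
-- sides of H₂ and into the four quadrants; each of them has a part of
-- discrepancy at most c.  With μ = c + |r - b|, the first two give
-- |w(H₁)| ≤ μ and |w(H₂)| ≤ μ, and whichever quadrant is light,
-- inclusion-exclusion yields d₂ ≤ 4 μ.
--
-- First inequality.  It suffices that c ≤ 16 d₂.  Sweep a vertical line over an
-- optimal partition into m parts.  The points at or below a part K, in a range
-- of columns where the part U directly above K stays the same, are cut out by
-- the line separating K from U and two vertical lines, so their weight is a
-- difference of the weights of two wedges and is at most 2 d₂.  The neighbour
-- above K changes only when it ends or a new one starts, and a part is the
-- upper neighbour of at most one part at a time, so there are at most 3 m such
-- ranges in total.  The same holds for the points at or above K, and
-- w(K) = w(at or below) + w(at or above) - w(strip).  Summing over K gives
-- m c ≤ Σ |w(K)| ≤ 14 m d₂.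

open import Defs
open import Algebra.Apartness.Bundles using (HeytingField)
import Algebra.Apartness.Properties.HeytingCommutativeRing as HeytingProperties
open import Algebra.Bundles using (CommutativeRing)
import Algebra.Properties.Ring as RingProperties
import Algebra.Properties.Semiring.Mult as Mult
import Algebra.Properties.Semiring.Sum as Sum
import Algebra.Solver.Ring as RingSolver
open import Algebra.Solver.Ring.AlmostCommutativeRing using (_-Raw-AlmostCommutative⟶_; fromCommutativeRing)
open import Data.Bool.Base using (Bool; true; false; _∧_; _∨_; not; if_then_else_)
open import Data.Bool.Properties using (∧-identityʳ)
open import Data.Empty using (⊥-elim)
open import Data.Fin.Base using (Fin; zero; suc; fromℕ; remQuot; combine)
open import Data.Fin.Patterns using (0F; 1F; 2F; 3F)
open import Data.Fin.Properties using (_≟_; all?; ¬∀⟶∃¬; sequence; remQuot-combine)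
open import Data.Fin.Subset using (Subset; _∈_; _∩_; ∣_∣; ⊤; Nonempty)
open import Data.Fin.Subset.Properties
  using (_∈?_; nonempty?; ∩-identityˡ; x∈p∩q⁺; x∈p∩q⁻; p⊆q⇒∣p∣≤∣q∣; p⊂q⇒∣p∣<∣q∣)
open import Data.Integer.Base as ℤ using (ℤ; -[1+_]; 0ℤ; 1ℤ)
import Data.Integer.Properties as ℤₚ
import Data.Integer.Tactic.RingSolver as ℤ-Solver
open import Data.Maybe.Base using (Maybe; just; nothing)
open import Data.Maybe.Properties using (≡-dec)
open import Data.Nat.Base as ℕ using (ℕ; z≤n; s≤s)
import Data.Nat.Properties as ℕₚ
import Data.Nat.Tactic.RingSolver as ℕ-Solver
open import Data.Product.Base using (∃-syntax; _×_; _,_; proj₁; proj₂)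
open import Data.Sum.Base using (_⊎_; inj₁; inj₂; [_,_]′; swap)
import Data.Unit.Base as Unit
open import Data.Vec.Base using (Vec; []; _∷_; lookup; tabulate; map; foldr₁)
open import Data.Vec.Properties using (lookup∘tabulate; []=⇒lookup; lookup⇒[]=; lookup-replicate)
open import Effect.Monad using (RawMonad)
open import Function.Base using (_∘_; case_of_; id; flip)
open import Function.Bundles using (_⇔_; mk⇔; module Equivalence)
open import Relation.Binary.Definitions using (tri<; tri≈; tri>)
open import Relation.Binary.PropositionalEquality as ≡ using (_≡_; _≢_; _≗_; refl; cong; cong₂)
open import Relation.Binary.Structures using (IsStrictPartialOrder)
open import Relation.Nullary.Decidable
  using (Dec; yes; no; does; dec-true; dec-false; decidable-stable; ¬¬-excluded-middle; _×-dec_)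
open import Relation.Nullary.Negation using (¬_; DoubleNegation; ¬¬-Monad; contradiction)
open import Algebra.Properties.Semiring.Sum ℕₚ.+-*-semiring using ()
  renaming (sum to sumℕ; ∑-distrib-+ to ∑ℕ-distrib-+)

-- Finite sums and weights of finite sets.

does⁻ : ∀ {a} {A : Set a} (A? : Dec A) → does A? ≡ true → A
does⁻ (yes x) _ = x

module _ where
  open import Data.Nat.Base
  open ℕₚ hiding (_≟_)
  open ≡
  open import Algebra.Properties.Semiring.Sum ℕₚ.+-*-semiring using (sum; ∑-comm; ∑-distrib-+)
  open import Algebra.Properties.Semiring.Sum ℤₚ.+-*-semiring using ()
    renaming (sum to sumℤ; ∑-distrib-+ to ∑ℤ-distrib-+; sum-cong-≗ to sumℤ-cong)

  -- The order axioms are asked for only on `P`: the vertical order of the parts is an order only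
  -- among parts that meet a common column. Totality returns a disjunction, and this is what the
  -- search branches on.
  least : ∀ {m p q} {P : Fin m → Set p} {_⊑_ : Fin m → Fin m → Set q} →
          (∀ i → Dec (P i)) →
          (∀ {i j} → P i → P j → i ⊑ j ⊎ j ⊑ i) →
          (∀ {i j k} → P i → P j → P k → i ⊑ j → j ⊑ k → i ⊑ k) →
          (∃[ i ] P i × (∀ j → P j → i ⊑ j)) ⊎ (∀ i → ¬ P i)
  least {zero} P? total trans′ = inj₂ λ ()
  least {suc m} {P = P} {_⊑_} P? total trans′
    with P? zero | least {P = P ∘ suc} {λ i j → suc i ⊑ suc j} (P? ∘ suc) total trans′
  ... | no ¬p | inj₂ none = inj₂ λ { zero → ¬p ; (suc i) → none i }
  ... | no ¬p | inj₁ (i , pᵢ , min) =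
    inj₁ (suc i , pᵢ , λ { zero p → contradiction p ¬p ; (suc j) → min j })
  ... | yes p | inj₂ none =
    inj₁ (zero , p , λ { zero q → [ (λ r → r) , (λ r → r) ]′ (total p q)
                       ; (suc j) q → contradiction q (none j) })
  ... | yes p | inj₁ (i , pᵢ , min) with total p pᵢ
  ...   | inj₁ 0⊑i = inj₁ (zero , p , λ { zero q → [ (λ r → r) , (λ r → r) ]′ (total p q)
                                        ; (suc j) q → trans′ p pᵢ q 0⊑i (min j q) })
  ...   | inj₂ i⊑0 = inj₁ (suc i , pᵢ , λ { zero q → i⊑0 ; (suc j) → min j })

  sum-mono-≤ : ∀ {n} {f g : Fin n → ℕ} → (∀ i → f i ≤ g i) → sum f ≤ sum g
  sum-mono-≤ {zero}  f≤g = z≤n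
  sum-mono-≤ {suc n} f≤g = +-mono-≤ (f≤g zero) (sum-mono-≤ (f≤g ∘ suc))

  sum-mono-< : ∀ {n} {f g : Fin n → ℕ} → (∀ i → f i ≤ g i) → ∀ i → f i < g i → sum f < sum g
  sum-mono-< f≤g zero    lt = +-mono-<-≤ lt (sum-mono-≤ (f≤g ∘ suc))
  sum-mono-< f≤g (suc i) lt = +-mono-≤-< (f≤g zero) (sum-mono-< (f≤g ∘ suc) i lt)

  sum-const : ∀ n k → sum {n} (λ _ → k) ≡ n * k
  sum-const zero    k = refl
  sum-const (suc n) k = cong (k +_) (sum-const n k)

  sum-*ˡ : ∀ {n} k (f : Fin n → ℕ) → sum (λ i → k * f i) ≡ k * sum f
  sum-*ˡ {zero}  k f = sym (*-zeroʳ k)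
  sum-*ˡ {suc n} k f = trans (cong (k * f zero +_) (sum-*ˡ k (f ∘ suc))) (sym (*-distribˡ-+ k (f zero) _))

  ⟦_⟧ : Bool → ℕ
  ⟦ true ⟧  = 1
  ⟦ false ⟧ = 0

  ⟦⟧≤1 : ∀ b → ⟦ b ⟧ ≤ 1
  ⟦⟧≤1 true  = s≤s z≤n
  ⟦⟧≤1 false = z≤n

  sum-⟦⟧≤1 : ∀ {n} (b : Fin n → Bool) → (∀ i j → b i ≡ true → b j ≡ true → i ≡ j) →
             sum (λ i → ⟦ b i ⟧) ≤ 1
  sum-⟦⟧≤1 {zero}  b unique = z≤n
  sum-⟦⟧≤1 {suc n} b unique with b zero in eq
  ... | false = sum-⟦⟧≤1 (b ∘ suc) λ i j bᵢ bⱼ → case unique (suc i) (suc j) bᵢ bⱼ of λ { refl → refl }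
  ... | true  = s≤s (≤-trans (sum-mono-≤ rest) (≤-reflexive (trans (sum-const n 0) (*-zeroʳ n))))
    where
    rest : ∀ i → ⟦ b (suc i) ⟧ ≤ 0
    rest i with b (suc i) in eqᵢ
    ... | false = z≤n
    ... | true  = case unique zero (suc i) eq eqᵢ of λ ()

  χ : Bool → ℤ
  χ true  = 1ℤ
  χ false = 0ℤ

  opaque
    weight : ∀ {n} → (Fin n → ℤ) → (Fin n → Bool) → ℤ
    weight w b = sumℤ λ p → χ (b p) ℤ.* w p

  opaque
    unfolding weight

    weight-cong : ∀ {n} (w : Fin n → ℤ) {b b′ : Fin n → Bool} → b ≗ b′ → weight w b ≡ weight w b′
    weight-cong w eq = sumℤ-cong λ p → cong (λ c → χ c ℤ.* w p) (eq p)

    -- The form in which inclusion-exclusion is used throughout: overlaps are allowed, and the sets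
    -- only have to match as sums of indicator functions. A missing fourth set is filled in by the
    -- empty one.
    weight-+ : ∀ {n} (w : Fin n → ℤ) (b₁ b₂ b₃ b₄ : Fin n → Bool) →
               (∀ p → χ (b₁ p) ℤ.+ χ (b₂ p) ≡ χ (b₃ p) ℤ.+ χ (b₄ p)) →
               weight w b₁ ℤ.+ weight w b₂ ≡ weight w b₃ ℤ.+ weight w b₄
    weight-+ w b₁ b₂ b₃ b₄ eq = begin
      weight w b₁ ℤ.+ weight w b₂                       ≡⟨ ∑ℤ-distrib-+ (λ p → χ (b₁ p) ℤ.* w p) (λ p → χ (b₂ p) ℤ.* w p) ⟨
      sumℤ (λ p → χ (b₁ p) ℤ.* w p ℤ.+ χ (b₂ p) ℤ.* w p) ≡⟨ sumℤ-cong (λ p → begin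
        χ (b₁ p) ℤ.* w p ℤ.+ χ (b₂ p) ℤ.* w p ≡⟨ ℤₚ.*-distribʳ-+ (w p) (χ (b₁ p)) (χ (b₂ p)) ⟨
        (χ (b₁ p) ℤ.+ χ (b₂ p)) ℤ.* w p       ≡⟨ cong (ℤ._* w p) (eq p) ⟩
        (χ (b₃ p) ℤ.+ χ (b₄ p)) ℤ.* w p       ≡⟨ ℤₚ.*-distribʳ-+ (w p) (χ (b₃ p)) (χ (b₄ p)) ⟩
        χ (b₃ p) ℤ.* w p ℤ.+ χ (b₄ p) ℤ.* w p ∎) ⟩
      sumℤ (λ p → χ (b₃ p) ℤ.* w p ℤ.+ χ (b₄ p) ℤ.* w p) ≡⟨ ∑ℤ-distrib-+ (λ p → χ (b₃ p) ℤ.* w p) (λ p → χ (b₄ p) ℤ.* w p) ⟩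
      weight w b₃ ℤ.+ weight w b₄ ∎
      where open ≡-Reasoning

    weight-∅ : ∀ {n} (w : Fin n → ℤ) → weight w (λ _ → false) ≡ 0ℤ
    weight-∅ {zero}  w = refl
    weight-∅ {suc n} w = cong₂ ℤ._+_ (ℤₚ.*-zeroˡ (w zero)) (weight-∅ (w ∘ suc))

  transpose : ∀ x y z → x ℤ.+ y ≡ z → x ≡ z ℤ.- y
  transpose x y z eq = trans (cancel x y) (cong (ℤ._- y) eq)
    where
    cancel : ∀ x y → x ≡ x ℤ.+ y ℤ.- y
    cancel = ℤ-Solver.solve-∀

  -- The combinatorics of the sweep.

  Occupies : ∀ {m} → (Fin m → ℕ) → (Fin m → ℕ) → ℕ → Fin m → Set
  Occupies l r j K = l K ≤ j × j ≤ r K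

  -- The parts of the partition are swept by a vertical line that stops at the
  -- columns j = 0, 1, …; the part K meets the sweep line from column l K to
  -- column r K, and ≺ is the vertical order of the parts along the sweep line.
  module SweepLine
    {n m : ℕ} (w : Fin n → ℤ) (ρ : Fin n → ℕ) (l r : Fin m → ℕ) (l≤r : ∀ K → l K ≤ r K)
    (_≺_ : Fin m → Fin m → Set) (_≺?_ : ∀ K L → Dec (K ≺ L))
    (≺-asym : ∀ {j K L} → Occupies l r j K → Occupies l r j L → K ≺ L → ¬ (L ≺ K))
    (≺-trans : ∀ {j K L M} → Occupies l r j K → Occupies l r j L → Occupies l r j M → K ≺ L → L ≺ M → K ≺ M)
    (≺-connected : ∀ {j K L} → Occupies l r j K → Occupies l r j L → K ≢ L → K ≺ L ⊎ L ≺ K)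
    where

    Active : ℕ → Fin m → Set
    Active = Occupies l r

    active? : ∀ j K → Dec (Active j K)
    active? j K = l K ≤? j ×-dec j ≤? r K

    IsNext : ℕ → Fin m → Maybe (Fin m) → Set
    IsNext j K nothing  = ∀ V → Active j V → ¬ (K ≺ V)
    IsNext j K (just U) = Active j U × K ≺ U × (∀ V → Active j V → K ≺ V → U ≡ V ⊎ U ≺ V)

    next-exists : ∀ j K → ∃[ N ] IsNext j K N
    next-exists j K with least {P = λ V → Active j V × K ≺ V} {λ U V → U ≡ V ⊎ U ≺ V}
      (λ V → active? j V ×-dec K ≺? V)
      (λ {U} {V} (aU , _) (aV , _) → case U ≟ V of λ where
        (yes U≡V) → inj₁ (inj₁ U≡V)
        (no U≢V)  → [ inj₁ ∘ inj₂ , inj₂ ∘ inj₂ ]′ (≺-connected aU aV U≢V))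
      (λ where
        _ _ _ (inj₁ refl) q → q
        _ _ _ (inj₂ p) (inj₁ refl) → inj₂ p
        (aU , _) (aV , _) (aW , _) (inj₂ p) (inj₂ q) → inj₂ (≺-trans aU aV aW p q))
    ... | inj₁ (U , (aU , K≺U) , min) = just U , aU , K≺U , λ V aV K≺V → min V (aV , K≺V)
    ... | inj₂ none = nothing , λ V aV K≺V → none V (aV , K≺V)

    next : ℕ → Fin m → Maybe (Fin m)
    next j K = proj₁ (next-exists j K)

    next-isNext : ∀ j K → IsNext j K (next j K)
    next-isNext j K = proj₂ (next-exists j K)

    next? : ∀ j K U → Dec (Active j K × next j K ≡ just U)
    next? j K U = active? j K ×-dec ≡-dec _≟_ (next j K) (just U)

    -- If two parts had the upper neighbour `U` in common, the higher of them would lie strictly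
    -- between the lower one and `U`.
    next-injective : ∀ j U K K′ → Active j K × next j K ≡ just U →
                     Active j K′ × next j K′ ≡ just U → K ≡ K′
    next-injective j U K K′ (aK , eq) (aK′ , eq′) with K ≟ K′
    ... | yes K≡K′ = K≡K′
    ... | no  K≢K′ = ⊥-elim (
      let (aU , K≺U , min)    = subst (IsNext j K) eq (next-isNext j K)
          (_ , K′≺U , min′)   = subst (IsNext j K′) eq′ (next-isNext j K′)
          absurd : ∀ {V} → Active j V → U ≡ V ⊎ U ≺ V → ¬ (V ≺ U)
          absurd aV = λ { (inj₁ refl) q → ≺-asym aU aU q q ; (inj₂ p) q → ≺-asym aU aV p q }
      in [ (λ K≺K′ → absurd aK′ (min K′ aK′ K≺K′) K′≺U)
         , (λ K′≺K → absurd aK (min′ K aK K′≺K) K≺U) ]′ (≺-connected aK aK′ K≢K′))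

    -- The neighbour above K can only change when it ends or when a new
    -- neighbour starts.
    next-change : ∀ j K → Active j K → Active (suc j) K → next j K ≢ next (suc j) K →
                  (∃[ U ] next j K ≡ just U × r U ≡ j) ⊎
                  (∃[ U ] next (suc j) K ≡ just U × l U ≡ suc j)
    next-change j K aK aK′ ≢next
      with next j K | next-isNext j K | next (suc j) K | next-isNext (suc j) K
    ... | nothing | none | nothing | _ = contradiction refl ≢next
    ... | nothing | none | just V | (lV , rV) , K≺V , _ =
      inj₂ (V , refl , ≤-antisym lV (≰⇒> λ lV≤j → none V (lV≤j , <⇒≤ rV) K≺V))
    ... | just U | (lU , rU) , K≺U , minU | N | isN with suc j ≤? r U
    ...   | no  j≮rU = inj₁ (U , refl , ≤-antisym (≮⇒≥ j≮rU) rU)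
    ...   | yes j<rU with N | isN
    ...     | nothing | none = contradiction K≺U (none U (m≤n⇒m≤1+n lU , j<rU))
    ...     | just V | aV@(lV , rV) , K≺V , minV =
      inj₂ (V , refl , ≤-antisym lV (≰⇒> λ lV≤j → noV (lV≤j , <⇒≤ rV)))
      where
      aU′ : Active (suc j) U
      aU′ = m≤n⇒m≤1+n lU , j<rU
      noV : ¬ Active j V
      noV aVj with minV U aU′ K≺U | minU V aVj K≺V
      ... | inj₁ refl | _         = ≢next refl
      ... | inj₂ V≺U  | inj₁ refl = ≢next refl
      ... | inj₂ V≺U  | inj₂ U≺V  = ≺-asym aV aU′ V≺U U≺V

    -- Events of the sweep that can alter the neighbour above `K`: the part `U` is that neighbour in
    -- its own last, respectively first, column.
    ends starts : Fin m → Fin m → Bool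
    ends   K U = does (next? (r U) K U)
    starts K U = does (next? (l U) K U)

    charge : Fin m → ℕ
    charge K = sum λ U → ⟦ ends K U ⟧ + ⟦ starts K U ⟧

    -- Double counting: after the sums are exchanged, each `U` is charged at most once for its last
    -- column and at most once for its first, because in a given column it is the upper neighbour of
    -- at most one active part.
    sum-charge≤ : sum charge ≤ 2 * m
    sum-charge≤ = begin
      sum charge                                          ≡⟨ ∑-comm (λ K U → ⟦ ends K U ⟧ + ⟦ starts K U ⟧) ⟩
      sum (λ U → sum λ K → ⟦ ends K U ⟧ + ⟦ starts K U ⟧) ≤⟨ sum-mono-≤ (λ U → begin
        sum (λ K → ⟦ ends K U ⟧ + ⟦ starts K U ⟧)
          ≡⟨ ∑-distrib-+ (λ K → ⟦ ends K U ⟧) (λ K → ⟦ starts K U ⟧) ⟩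
        sum (λ K → ⟦ ends K U ⟧) + sum (λ K → ⟦ starts K U ⟧)
          ≤⟨ +-mono-≤ (atMostOne (r U) U) (atMostOne (l U) U) ⟩
        2 ∎) ⟩
      sum {m} (λ _ → 2)                                   ≡⟨ trans (sum-const m 2) (*-comm m 2) ⟩
      2 * m                                               ∎
      where
      open ≤-Reasoning
      atMostOne : ∀ j U → sum (λ K → ⟦ does (next? j K U) ⟧) ≤ 1
      atMostOne j U = sum-⟦⟧≤1 _ λ K K′ t t′ →
        next-injective j U K K′ (does⁻ (next? j K U) t) (does⁻ (next? j K′ U) t′)

    -- An end is counted only after the last column of `U`, a start already in its first column.
    -- With this choice a change of neighbour between columns `j` and `suc j` is first counted at
    -- `suc j` in both cases.
    chargeAt : Fin m → ℕ → Fin m → ℕ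
    chargeAt K j U = ⟦ ends K U ∧ does (r U <? j) ⟧ + ⟦ starts K U ∧ does (l U ≤? j) ⟧

    chargeUpTo : Fin m → ℕ → ℕ
    chargeUpTo K j = sum (chargeAt K j)

    ⟦⟧-mono : ∀ {p q} {P : Set p} {Q : Set q} b (P? : Dec P) (Q? : Dec Q) → (P → Q) →
              ⟦ b ∧ does P? ⟧ ≤ ⟦ b ∧ does Q? ⟧
    ⟦⟧-mono false _ _ _ = z≤n
    ⟦⟧-mono true (no _)  _       _   = z≤n
    ⟦⟧-mono true (yes p) (yes _) _   = ≤-refl
    ⟦⟧-mono true (yes p) (no ¬q) p⇒q = contradiction (p⇒q p) ¬q

    ⟦⟧-∧ : ∀ b c → ⟦ b ∧ c ⟧ ≤ ⟦ b ⟧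
    ⟦⟧-∧ false c = z≤n
    ⟦⟧-∧ true  c = ⟦⟧≤1 c

    chargeUpTo≤ : ∀ K j → chargeUpTo K j ≤ charge K
    chargeUpTo≤ K j = sum-mono-≤ λ U → +-mono-≤ (⟦⟧-∧ (ends K U) _) (⟦⟧-∧ (starts K U) _)

    chargeAt-mono : ∀ K j U → chargeAt K j U ≤ chargeAt K (suc j) U
    chargeAt-mono K j U = +-mono-≤
      (⟦⟧-mono (ends K U) (r U <? j) (r U <? suc j) m<n⇒m<1+n)
      (⟦⟧-mono (starts K U) (l U ≤? j) (l U ≤? suc j) m≤n⇒m≤1+n)

    ⟦⟧-strict : ∀ {p q} {P : Set p} {Q : Set q} {b} (P? : Dec P) (Q? : Dec Q) →
                b ≡ true → ¬ P → Q → ⟦ b ∧ does P? ⟧ < ⟦ b ∧ does Q? ⟧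
    ⟦⟧-strict (yes p) Q? refl ¬p q = contradiction p ¬p
    ⟦⟧-strict (no _) (no ¬q) refl ¬p q = contradiction q ¬q
    ⟦⟧-strict (no _) (yes _) refl ¬p q = ≤-refl

    chargeUpTo-change : ∀ j K → Active j K → Active (suc j) K → next j K ≢ next (suc j) K →
                        chargeUpTo K j < chargeUpTo K (suc j)
    chargeUpTo-change j K aK aK′ ≢next with next-change j K aK aK′ ≢next
    ... | inj₁ (U , eq , refl) = sum-mono-< (chargeAt-mono K j) U (+-mono-<-≤
      (⟦⟧-strict (r U <? j) (r U <? suc j) (dec-true (next? (r U) K U) (aK , eq)) (<-irrefl refl) ≤-refl)
      (⟦⟧-mono (starts K U) (l U ≤? j) (l U ≤? suc j) m≤n⇒m≤1+n))
    ... | inj₂ (U , eq , lU≡) = sum-mono-< (chargeAt-mono K j) U (+-mono-≤-<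
      (⟦⟧-mono (ends K U) (r U <? j) (r U <? suc j) m<n⇒m<1+n)
      (⟦⟧-strict (l U ≤? j) (l U ≤? suc j)
        (dec-true (next? (l U) K U) (subst (λ i → Active i K × next i K ≡ just U) (sym lU≡) (aK′ , eq)))
        (<⇒≱ (≤-reflexive (sym lU≡))) (≤-reflexive lU≡)))

    below : ℕ → Fin n → Bool
    below j p = does (ρ p <? j)

    within : Fin m → ℕ → Fin n → Bool
    within K j p = does (l K ≤? ρ p) ∧ does (ρ p <? j)

    -- `side K N` models the points on the side of `K` of a line separating `K` from its neighbour
    -- `N`. It agrees with `low K` only in the columns where `N` is that neighbour, but its
    -- truncations by vertical lines have bounded weight.
    module _
      (low : Fin m → Fin n → Bool)
      (side : Fin m → Maybe (Fin m) → Fin n → Bool)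
      (side≡low : ∀ p K N → Active (ρ p) K → IsNext (ρ p) K N → side K N p ≡ low K p)
      (D : ℕ)
      (bound : ∀ K N j → ℤ.∣ weight w (λ p → below j p ∧ side K N p) ∣ ≤ D)
      where

      private
        T : Fin m → ℕ → ℤ
        T K j = weight w λ p → within K j p ∧ low K p

        A : Fin m → Maybe (Fin m) → ℕ → ℤ
        A K N j = weight w λ p → below j p ∧ side K N p

      T-start : ∀ K → T K (l K) ≡ 0ℤ
      T-start K = trans (weight-cong w {b′ = λ _ → false} empty) (weight-∅ w)
        where
        empty : ∀ p → within K (l K) p ∧ low K p ≡ false
        empty p with l K ≤? ρ p
        ... | no  lK≰ρ rewrite dec-false (l K ≤? ρ p) lK≰ρ = refl
        ... | yes lK≤ρ rewrite dec-true (l K ≤? ρ p) lK≤ρ | dec-false (ρ p <? l K) (≤⇒≯ lK≤ρ) = refl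

      -- Advancing past column `j` adds the same weight to both quantities, since in that column
      -- `low K` coincides with the side given by the current neighbour.
      T-step : ∀ K j → Active j K →
               T K (suc j) ℤ.+ A K (next j K) j ≡ T K j ℤ.+ A K (next j K) (suc j)
      T-step K j aK@(lK≤j , _) = weight-+ w _ _ _ _ pointwise
        where
        pointwise : ∀ p → χ (within K (suc j) p ∧ low K p) ℤ.+ χ (below j p ∧ side K (next j K) p) ≡
                          χ (within K j p ∧ low K p) ℤ.+ χ (below (suc j) p ∧ side K (next j K) p)
        pointwise p with <-cmp (ρ p) j
        ... | tri< ρ<j _ _ rewrite dec-true (ρ p <? j) ρ<j | dec-true (ρ p <? suc j) (m<n⇒m<1+n ρ<j) = refl
        ... | tri> _ _ ρ>j rewrite dec-false (ρ p <? j) (<⇒≯ ρ>j) | dec-false (ρ p <? suc j) (≤⇒≯ ρ>j) = refl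
        ... | tri≈ _ refl _
          rewrite dec-false (ρ p <? j) (<-irrefl refl) | dec-true (ρ p <? suc j) ≤-refl
                | dec-true (l K ≤? ρ p) lK≤j
                | side≡low p K (next j K) aK (next-isNext j K) = ℤₚ.+-comm (χ (low K p)) 0ℤ

      -- The difference of `T` and `A` is constant while the neighbour stays the same. A change of
      -- neighbour replaces one truncated side by another and costs at most `2 * D`, which the
      -- growth of `chargeUpTo` pays for. At the start the strip is empty and a single `A`, of size
      -- at most `D`, remains.
      T-invariant : ∀ K d → l K + d ≤ r K →
                    ℤ.∣ T K (l K + d) ℤ.- A K (next (l K + d) K) (l K + d) ∣ ≤
                    D + 2 * D * chargeUpTo K (l K + d)
      T-invariant K zero _ rewrite +-identityʳ (l K) | T-start K = begin
        ℤ.∣ 0ℤ ℤ.- A K (next (l K) K) (l K) ∣ ≡⟨ cong ℤ.∣_∣ (ℤₚ.+-identityˡ (ℤ.- A K (next (l K) K) (l K))) ⟩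
        ℤ.∣ ℤ.- A K (next (l K) K) (l K) ∣    ≡⟨ ℤₚ.∣-i∣≡∣i∣ (A K (next (l K) K) (l K)) ⟩
        ℤ.∣ A K (next (l K) K) (l K) ∣        ≤⟨ bound K (next (l K) K) (l K) ⟩
        D                                     ≤⟨ m≤m+n D _ ⟩
        D + 2 * D * chargeUpTo K (l K)        ∎
        where open ≤-Reasoning
      T-invariant K (suc d) l+d≤r rewrite +-suc (l K) d with l K + d in eq-j
      ... | j = step
        where
        open ≤-Reasoning
        l≤j : l K ≤ j
        l≤j = subst (l K ≤_) eq-j (m≤m+n (l K) d)
        aK : Active j K
        aK = l≤j , <⇒≤ l+d≤r
        aK′ : Active (suc j) K
        aK′ = m≤n⇒m≤1+n l≤j , l+d≤r
        ih : ℤ.∣ T K j ℤ.- A K (next j K) j ∣ ≤ D + 2 * D * chargeUpTo K j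
        ih = subst (λ j → ℤ.∣ T K j ℤ.- A K (next j K) j ∣ ≤ D + 2 * D * chargeUpTo K j) eq-j
               (T-invariant K d (subst (_≤ r K) (sym eq-j) (<⇒≤ l+d≤r)))
        cancel : ∀ t a b → t ℤ.+ b ℤ.- a ℤ.- b ≡ t ℤ.- a
        cancel = ℤ-Solver.solve-∀
        advance : T K (suc j) ℤ.- A K (next j K) (suc j) ≡ T K j ℤ.- A K (next j K) j
        advance = trans
          (cong (ℤ._- A K (next j K) (suc j)) (transpose (T K (suc j)) (A K (next j K) j) _ (T-step K j aK)))
          (cancel (T K j) (A K (next j K) j) (A K (next j K) (suc j)))
        split : ∀ t a b → t ℤ.- b ≡ t ℤ.- a ℤ.+ (a ℤ.- b)
        split = ℤ-Solver.solve-∀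
        arith : ∀ D c → D + 2 * D * c + (D + D) ≡ D + 2 * D * suc c
        arith = ℕ-Solver.solve-∀
        step : ℤ.∣ T K (suc j) ℤ.- A K (next (suc j) K) (suc j) ∣ ≤ D + 2 * D * chargeUpTo K (suc j)
        step with ≡-dec _≟_ (next j K) (next (suc j) K)
        ... | yes eq = begin
          ℤ.∣ T K (suc j) ℤ.- A K (next (suc j) K) (suc j) ∣
            ≡⟨ cong (λ N → ℤ.∣ T K (suc j) ℤ.- A K N (suc j) ∣) eq ⟨
          ℤ.∣ T K (suc j) ℤ.- A K (next j K) (suc j) ∣ ≡⟨ cong ℤ.∣_∣ advance ⟩
          ℤ.∣ T K j ℤ.- A K (next j K) j ∣             ≤⟨ ih ⟩
          D + 2 * D * chargeUpTo K j
            ≤⟨ +-monoʳ-≤ D (*-monoʳ-≤ (2 * D) (sum-mono-≤ (chargeAt-mono K j))) ⟩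
          D + 2 * D * chargeUpTo K (suc j)             ∎
        ... | no ≢next = begin
          ℤ.∣ T K (suc j) ℤ.- A K (next (suc j) K) (suc j) ∣
            ≡⟨ cong ℤ.∣_∣ (split (T K (suc j)) (A K (next j K) (suc j)) _) ⟩
          ℤ.∣ T K (suc j) ℤ.- A K (next j K) (suc j) ℤ.+ (A K (next j K) (suc j) ℤ.- A K (next (suc j) K) (suc j)) ∣
            ≡⟨ cong (λ z → ℤ.∣ z ℤ.+ (A K (next j K) (suc j) ℤ.- A K (next (suc j) K) (suc j)) ∣) advance ⟩
          ℤ.∣ T K j ℤ.- A K (next j K) j ℤ.+ (A K (next j K) (suc j) ℤ.- A K (next (suc j) K) (suc j)) ∣
            ≤⟨ ℤₚ.∣i+j∣≤∣i∣+∣j∣ (T K j ℤ.- A K (next j K) j) _ ⟩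
          ℤ.∣ T K j ℤ.- A K (next j K) j ∣ + ℤ.∣ A K (next j K) (suc j) ℤ.- A K (next (suc j) K) (suc j) ∣
            ≤⟨ +-mono-≤ ih (≤-trans (ℤₚ.∣i-j∣≤∣i∣+∣j∣ (A K (next j K) (suc j)) _) (+-mono-≤ (bound K (next j K) (suc j)) (bound K (next (suc j) K) (suc j)))) ⟩
          D + 2 * D * chargeUpTo K j + (D + D)         ≡⟨ arith D (chargeUpTo K j) ⟩
          D + 2 * D * suc (chargeUpTo K j)
            ≤⟨ +-monoʳ-≤ D (*-monoʳ-≤ (2 * D) (chargeUpTo-change j K aK aK′ ≢next)) ⟩
          D + 2 * D * chargeUpTo K (suc j)             ∎

      -- The invariant is available up to column `r K`, the last one in which `K` is active.
      -- Crossing this column adds one more truncated side.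
      ∣T∣≤ : ∀ K → ℤ.∣ T K (suc (r K)) ∣ ≤ 2 * D + 2 * D * charge K
      ∣T∣≤ K = begin
        ℤ.∣ T K (suc j) ∣ ≡⟨ cong ℤ.∣_∣ (trans (transpose (T K (suc j)) a (T K j ℤ.+ b) (T-step K j (l≤r K , ≤-refl)))
                                       (commute (T K j) a b)) ⟩
        ℤ.∣ T K j ℤ.- a ℤ.+ b ∣ ≤⟨ ℤₚ.∣i+j∣≤∣i∣+∣j∣ (T K j ℤ.- a) b ⟩
        ℤ.∣ T K j ℤ.- a ∣ + ℤ.∣ b ∣ ≤⟨ +-mono-≤ invariant (bound K (next j K) (suc j)) ⟩
        D + 2 * D * chargeUpTo K j + D ≤⟨ +-monoˡ-≤ D (+-monoʳ-≤ D (*-monoʳ-≤ (2 * D) (chargeUpTo≤ K j))) ⟩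
        D + 2 * D * charge K + D ≡⟨ arith D (charge K) ⟩
        2 * D + 2 * D * charge K ∎
        where
        open ≤-Reasoning
        j = r K
        a = A K (next j K) j
        b = A K (next j K) (suc j)
        commute : ∀ t a b → t ℤ.+ b ℤ.- a ≡ t ℤ.- a ℤ.+ b
        commute = ℤ-Solver.solve-∀
        arith : ∀ D c → D + 2 * D * c + D ≡ 2 * D + 2 * D * c
        arith = ℕ-Solver.solve-∀
        invariant : ℤ.∣ T K j ℤ.- a ∣ ≤ D + 2 * D * chargeUpTo K j
        invariant = subst (λ j → ℤ.∣ T K j ℤ.- A K (next j K) j ∣ ≤ D + 2 * D * chargeUpTo K j)
          (m+[n∸m]≡n (l≤r K)) (T-invariant K (r K ∸ l K) (≤-reflexive (m+[n∸m]≡n (l≤r K))))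

      -- Each part contributes `2 * D` by itself, and the at most `2 * m` events contribute `2 * D`
      -- each.
      sum-∣T∣≤ : sum (λ K → ℤ.∣ T K (suc (r K)) ∣) ≤ 6 * D * m
      sum-∣T∣≤ = begin
        sum (λ K → ℤ.∣ T K (suc (r K)) ∣) ≤⟨ sum-mono-≤ ∣T∣≤ ⟩
        sum (λ K → 2 * D + 2 * D * charge K) ≡⟨ ∑-distrib-+ {m} (λ _ → 2 * D) (λ K → 2 * D * charge K) ⟩
        sum {m} (λ _ → 2 * D) + sum (λ K → 2 * D * charge K)
          ≡⟨ cong₂ _+_ (sum-const m (2 * D)) (sum-*ˡ (2 * D) charge) ⟩
        m * (2 * D) + 2 * D * sum charge ≤⟨ +-monoʳ-≤ (m * (2 * D)) (*-monoʳ-≤ (2 * D) sum-charge≤) ⟩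
        m * (2 * D) + 2 * D * (2 * m) ≡⟨ arith m D ⟩
        6 * D * m ∎
        where
        open ≤-Reasoning
        arith : ∀ m D → m * (2 * D) + 2 * D * (2 * m) ≡ 6 * D * m
        arith = ℕ-Solver.solve-∀

-- Double negation.

infixl 1 _>>=_

_>>=_ : ∀ {a b} {A : Set a} {B : Set b} → DoubleNegation A → (A → DoubleNegation B) → DoubleNegation B
(m >>= f) k = m λ x → f x k

return : ∀ {a} {A : Set a} → A → DoubleNegation A
return x k = k x

-- This exchange is constructive because the family is finite; points, parts and half-planes all
-- come in finite families.
¬¬-∀ : ∀ {n p} {P : Fin n → Set p} → (∀ i → DoubleNegation (P i)) → DoubleNegation (∀ i → P i)
¬¬-∀ = sequence (RawMonad.rawApplicative ¬¬-Monad)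

-- Ordered-field arithmetic

module OrderedField (𝓡 : RealNumbers) where
  open RealNumbers 𝓡
  open HeytingField heytingField
    using (_-_; -_; tight; #⇒invertible; setoid)
  open CommutativeRing commutativeRing
    using (semiring; ring; +-cong; *-cong; -‿cong; +-comm; +-identityˡ; +-identityʳ; zeroˡ; zeroʳ)
    renaming (refl to ≈-refl; sym to ≈-sym; trans to ≈-trans; reflexive to ≈-reflexive)
  module R = CommutativeRing commutativeRing
  open IsStrictPartialOrder isStrictPartialOrder
    using (<-respʳ-≈; <-respˡ-≈) renaming (irrefl to <-irrefl; trans to <-trans; asym to <-asym)
  open Mult semiring using (×-homo-+; ×1-homo-*)
  module Σ = Sum semiring
  open import Relation.Binary.Reasoning.Setoid setoid

  -- The canonical ring homomorphism from the integers. It provides the ring solver with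
  -- coefficients whose equality is decidable.
  ι : ℤ → ℝ
  ι (ℤ.+ n)    = n · 1#
  ι -[1+ n ] = - (ℕ.suc n · 1#)

  private module RP = RingProperties ring
  open RP using (-‿distribˡ-*; -‿distribʳ-*; -‿+-comm; -0#≈0#; -‿involutive)

  ι-neg : ∀ i → ι (ℤ.- i) ≈ - ι i
  ι-neg (ℤ.+ ℕ.zero)  = ≈-sym -0#≈0#
  ι-neg (ℤ.+ ℕ.suc n) = ≈-refl
  ι-neg -[1+ n ]      = ≈-sym (-‿involutive _)

  ι-⊖ : ∀ m n → ι (m ℤ.⊖ n) ≈ m · 1# - n · 1#
  ι-⊖ m ℕ.zero = ≈-sym (≈-trans (+-cong ≈-refl -0#≈0#) (+-identityʳ _))
  ι-⊖ ℕ.zero (ℕ.suc n) = ≈-sym (+-identityˡ _)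
  ι-⊖ (ℕ.suc m) (ℕ.suc n) = begin
    ι (ℕ.suc m ℤ.⊖ ℕ.suc n)              ≡⟨ cong ι (ℤₚ.[1+m]⊖[1+n]≡m⊖n m n) ⟩
    ι (m ℤ.⊖ n)                          ≈⟨ ι-⊖ m n ⟩
    M - N                                ≈⟨ +-cong (≈-sym (+-identityʳ M)) ≈-refl ⟩
    (M + 0#) - N                         ≈⟨ +-cong (+-cong ≈-refl (R.-‿inverseʳ 1#)) ≈-refl ⟨
    (M + (1# - 1#)) - N                  ≈⟨ +-cong (R.+-assoc M 1# (- 1#)) ≈-refl ⟨
    (M + 1# - 1#) - N                    ≈⟨ R.+-assoc _ _ _ ⟩
    M + 1# + (- 1# - N)                  ≈⟨ +-cong (+-comm M 1#) (-‿+-comm 1# N) ⟩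
    1# + M - (1# + N)                    ∎
    where M = m · 1#
          N = n · 1#

  ι-+ : ∀ i j → ι (i ℤ.+ j) ≈ ι i + ι j
  ι-+ (ℤ.+ m)  (ℤ.+ n)  = ×-homo-+ 1# m n
  ι-+ (ℤ.+ m)  -[1+ n ] = ι-⊖ m (ℕ.suc n)
  ι-+ -[1+ m ] (ℤ.+ n)  = ≈-trans (ι-⊖ n (ℕ.suc m)) (+-comm _ _)
  ι-+ -[1+ m ] -[1+ n ] = begin
    ι (-[1+ m ] ℤ.+ -[1+ n ])                        ≡⟨ cong ι (ℤₚ.neg-distrib-+ (ℤ.+ ℕ.suc m) (ℤ.+ ℕ.suc n)) ⟨
    - ((ℕ.suc m ℕ.+ ℕ.suc n) · 1#)                   ≈⟨ -‿cong (×-homo-+ 1# (ℕ.suc m) (ℕ.suc n)) ⟩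
    - (ℕ.suc m · 1# + ℕ.suc n · 1#)                  ≈⟨ -‿+-comm _ _ ⟨
    - (ℕ.suc m · 1#) - ℕ.suc n · 1#                  ∎

  ι-*-pos : ∀ m j → ι (ℤ.+ m ℤ.* j) ≈ m · 1# * ι j
  ι-*-pos m (ℤ.+ n) = ≈-trans (≈-reflexive (cong ι (≡.sym (ℤₚ.pos-* m n)))) (×1-homo-* m n)
  ι-*-pos m -[1+ n ] = begin
    ι (ℤ.+ m ℤ.* -[1+ n ])            ≡⟨ cong ι (ℤₚ.neg-distribʳ-* (ℤ.+ m) (ℤ.+ ℕ.suc n)) ⟨
    ι (ℤ.- (ℤ.+ m ℤ.* ℤ.+ ℕ.suc n))   ≈⟨ ι-neg (ℤ.+ m ℤ.* ℤ.+ ℕ.suc n) ⟩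
    - ι (ℤ.+ m ℤ.* ℤ.+ ℕ.suc n)       ≈⟨ -‿cong (ι-*-pos m (ℤ.+ ℕ.suc n)) ⟩
    - (m · 1# * (ℕ.suc n · 1#))       ≈⟨ -‿distribʳ-* _ _ ⟩
    m · 1# * - (ℕ.suc n · 1#)         ∎

  ι-* : ∀ i j → ι (i ℤ.* j) ≈ ι i * ι j
  ι-* (ℤ.+ m) j = ι-*-pos m j
  ι-* -[1+ m ] j = begin
    ι (-[1+ m ] ℤ.* j)            ≡⟨ cong ι (ℤₚ.neg-distribˡ-* (ℤ.+ ℕ.suc m) j) ⟨
    ι (ℤ.- (ℤ.+ ℕ.suc m ℤ.* j))   ≈⟨ ι-neg (ℤ.+ ℕ.suc m ℤ.* j) ⟩
    - ι (ℤ.+ ℕ.suc m ℤ.* j)       ≈⟨ -‿cong (ι-*-pos (ℕ.suc m) j) ⟩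
    - (ℕ.suc m · 1# * ι j)        ≈⟨ -‿distribˡ-* _ _ ⟩
    - (ℕ.suc m · 1#) * ι j        ∎

  almostCommutativeRing = fromCommutativeRing commutativeRing

  ι-morphism : ℤ.+-*-rawRing -Raw-AlmostCommutative⟶ almostCommutativeRing
  ι-morphism = record
    { ⟦_⟧    = ι
    ; +-homo = ι-+
    ; *-homo = ι-*
    ; -‿homo = ι-neg
    ; 0-homo = ≈-refl
    ; 1-homo = +-identityʳ 1#
    }

  ι-≟ : ∀ i j → Maybe (ι i ≈ ι j)
  ι-≟ i j with i ℤₚ.≟ j
  ... | yes i≡j = just (≈-reflexive (cong ι i≡j))
  ... | no _    = nothing

  module Solver = RingSolver ℤ.+-*-rawRing almostCommutativeRing ι-morphism ι-≟
  open Solver using (solve; _:=_; _:+_; _:*_; _:-_; :-_; con)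

  <-resp-≈ : ∀ {x x′ y y′} → x ≈ x′ → y ≈ y′ → x < y → x′ < y′
  <-resp-≈ x≈ y≈ = <-respˡ-≈ x≈ ∘ <-respʳ-≈ y≈

  ≤-resp-≈ : ∀ {x x′ y y′} → x ≈ x′ → y ≈ y′ → x ≤ y → x′ ≤ y′
  ≤-resp-≈ x≈ y≈ x≤y = x≤y ∘ <-resp-≈ (≈-sym y≈) (≈-sym x≈)

  ≈⇒≤ : ∀ {x y} → x ≈ y → x ≤ y
  ≈⇒≤ x≈y = <-irrefl (≈-sym x≈y)

  <⇒≤ : ∀ {x y} → x < y → x ≤ y
  <⇒≤ = <-asym

  -- By tightness, two reals that are not apart are equal, so the only classical step is to decide
  -- apartness.
  trichotomy : ∀ x y → DoubleNegation (x < y ⊎ x ≈ y ⊎ y < x)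
  trichotomy x y = ¬¬-excluded-middle >>= λ where
    (yes x#y) → return (case Equivalence.to #⇔<⊎> x#y of λ where
      (inj₁ x<y) → inj₁ x<y
      (inj₂ y<x) → inj₂ (inj₂ y<x))
    (no ¬x#y) → return (inj₂ (inj₁ (proj₁ (tight x y) ¬x#y)))

  ≤-split : ∀ {x y} → x ≤ y → DoubleNegation (x < y ⊎ x ≈ y)
  ≤-split {x} {y} x≤y = trichotomy x y >>= λ where
    (inj₁ x<y)        → return (inj₁ x<y)
    (inj₂ (inj₁ x≈y)) → return (inj₂ x≈y)
    (inj₂ (inj₂ y<x)) → ⊥-elim (x≤y y<x)

  ≤-antisym : ∀ {x y} → x ≤ y → y ≤ x → x ≈ y
  ≤-antisym x≤y y≤x = proj₁ (tight _ _) λ x#y →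
    [ y≤x , x≤y ]′ (Equivalence.to #⇔<⊎> x#y)

  <-≤-trans : ∀ {x y z} → x < y → y ≤ z → DoubleNegation (x < z)
  <-≤-trans x<y y≤z = ≤-split y≤z >>= λ where
    (inj₁ y<z) → return (<-trans x<y y<z)
    (inj₂ y≈z) → return (<-respʳ-≈ y≈z x<y)

  ≤-trans : ∀ {x y z} → x ≤ y → y ≤ z → x ≤ z
  ≤-trans x≤y y≤z z<x = <-≤-trans z<x x≤y (y≤z)

  <⇒0< : ∀ {x y} → x < y → 0# < y - x
  <⇒0< {x} = <-respˡ-≈ (R.-‿inverseʳ x) ∘ +-monoˡ-< (- x)

  0<⇒< : ∀ {x y} → 0# < y - x → x < y
  0<⇒< {x} {y} = <-resp-≈ (+-identityˡ x) (solve 2 (λ x y → y :- x :+ x := y) ≈-refl x y) ∘ +-monoˡ-< x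

  ≤⇒0≤ : ∀ {x y} → x ≤ y → 0# ≤ y - x
  ≤⇒0≤ {x} {y} x≤y = x≤y ∘ <-resp-≈ (solve 2 (λ x y → y :- x :+ x := y) ≈-refl x y) (+-identityˡ x) ∘ +-monoˡ-< x

  0≤⇒≤ : ∀ {x y} → 0# ≤ y - x → x ≤ y
  0≤⇒≤ {x} 0≤ = 0≤ ∘ <-respʳ-≈ (R.-‿inverseʳ x) ∘ +-monoˡ-< (- x)

  -- Inequalities are proved by exhibiting the difference of their sides as a
  -- combination of quantities of known sign.
  by-< : ∀ {x y} e → y - x ≈ e → 0# < e → x < y
  by-< e eq = 0<⇒< ∘ <-respʳ-≈ (≈-sym eq)

  by-≤ : ∀ {x y} e → y - x ≈ e → 0# ≤ e → x ≤ y
  by-≤ e eq = 0≤⇒≤ ∘ ≤-resp-≈ ≈-refl (≈-sym eq)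

  0<+0< : ∀ {x y} → 0# < x → 0# < y → 0# < x + y
  0<+0< {x} {y} 0<x 0<y = <-trans 0<y (<-respˡ-≈ (+-identityˡ y) (+-monoˡ-< y 0<x))

  0≤+0≤ : ∀ {x y} → 0# ≤ x → 0# ≤ y → 0# ≤ x + y
  0≤+0≤ {x} {y} 0≤x 0≤y x+y<0 = (≤-split 0≤x) λ where
    (inj₁ 0<x) → 0≤y (<-trans (<-respˡ-≈ (+-identityˡ y) (+-monoˡ-< y 0<x)) x+y<0)
    (inj₂ 0≈x) → 0≤y (<-respˡ-≈ (≈-trans (+-cong (≈-sym 0≈x) ≈-refl) (+-identityˡ y)) x+y<0)

  0≤*0≤ : ∀ {x y} → 0# ≤ x → 0# ≤ y → 0# ≤ x * y
  0≤*0≤ {x} {y} 0≤x 0≤y xy<0 = ≤-split 0≤x λ where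
    (inj₂ 0≈x) → <-irrefl (≈-trans (*-cong (≈-sym 0≈x) ≈-refl) (zeroˡ y)) xy<0
    (inj₁ 0<x) → ≤-split 0≤y λ where
      (inj₂ 0≈y) → <-irrefl (≈-trans (*-cong ≈-refl (≈-sym 0≈y)) (zeroʳ x)) xy<0
      (inj₁ 0<y) → <-asym xy<0 (*-pos 0<x 0<y)

  neg-pos : ∀ {x} → x < 0# → 0# < - x
  neg-pos {x} = <-respʳ-≈ (+-identityˡ (- x)) ∘ <⇒0<

  0<1 : 0# < 1#
  0<1 = case Equivalence.to #⇔<⊎> (HeytingProperties.1#0 heytingCommutativeRing) of λ where
    (inj₂ 0<1) → 0<1
    (inj₁ 1<0) → <-respʳ-≈
      (≈-trans (solve 1 (λ o → (:- o) :* (:- o) := o :* o) ≈-refl 1#) (R.*-identityˡ 1#))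
      (*-pos (neg-pos 1<0) (neg-pos 1<0))

  inverse : ∀ {x} → 0# < x → DoubleNegation (∃[ r ] 0# < r × r * x ≈ 1#)
  inverse {x} 0<x with #⇒invertible (Equivalence.from #⇔<⊎> (inj₂ 0<x))
  -- Invertibility concerns `x - 0#`. The sign of `r` follows from `r * x ≈ 1#`, since the other
  -- signs contradict `0# < 1#`.
  ... | r , r*[x-0]≈1 , _ = trichotomy 0# r >>= λ where
      (inj₁ 0<r)        → return (r , 0<r , r*x≈1)
      (inj₂ (inj₁ 0≈r)) → ⊥-elim (<-irrefl
        (≈-trans (≈-trans (≈-sym (zeroˡ x)) (*-cong 0≈r ≈-refl)) r*x≈1) 0<1)
      (inj₂ (inj₂ r<0)) → ⊥-elim (<-asym 0<1 (by-< (- r * x)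
        (≈-trans (+-cong ≈-refl (-‿cong (≈-sym r*x≈1))) (solve 2 (λ r x → con ℤ.0ℤ :- r :* x := :- r :* x) ≈-refl r x))
        (*-pos (neg-pos r<0) 0<x)))
    where
    r*x≈1 : r * x ≈ 1#
    r*x≈1 = ≈-trans (*-cong ≈-refl (solve 1 (λ x → x := x :- con ℤ.0ℤ) ≈-refl x)) r*[x-0]≈1

  -- Rescaling by the inverse of `s + t` turns nonnegative weights into the coefficients of a convex
  -- combination.
  normalise : ∀ {s t} → 0# ≤ s → 0# ≤ t → 0# < s + t →
              DoubleNegation (∃[ r ] 0# < r × 0# ≤ r * s × 0# ≤ r * t × r * s + r * t ≈ 1#)
  normalise {s} {t} 0≤s 0≤t 0<s+t = inverse 0<s+t >>= λ where
    (r , 0<r , eq) → return (r , 0<r , 0≤*0≤ (<⇒≤ 0<r) 0≤s , 0≤*0≤ (<⇒≤ 0<r) 0≤t ,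
      ≈-trans (solve 3 (λ r s t → r :* s :+ r :* t := r :* (s :+ t)) ≈-refl r s t) eq)

  -- Finite families of reals and linear inequalities in one unknown.

  sum-0≤ : ∀ {n} {f : Fin n → ℝ} → (∀ i → 0# ≤ f i) → 0# ≤ sum f
  sum-0≤ {ℕ.zero}  0≤f = <-irrefl ≈-refl
  sum-0≤ {ℕ.suc n} 0≤f = 0≤+0≤ (0≤f zero) (sum-0≤ (0≤f ∘ suc))

  sum≤0⇒≤0 : ∀ {n} {f : Fin n → ℝ} → (∀ i → 0# ≤ f i) → sum f ≤ 0# → ∀ i → f i ≤ 0#
  sum≤0⇒≤0 {f = f} 0≤f Σ≤0 zero = ≤-trans
    (by-≤ (sum (f ∘ suc)) (solve 2 (λ x y → x :+ y :- x := y) ≈-refl (f zero) (sum (f ∘ suc))) (sum-0≤ (0≤f ∘ suc)))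
    Σ≤0
  sum≤0⇒≤0 {f = f} 0≤f Σ≤0 (suc i) = sum≤0⇒≤0 (0≤f ∘ suc) (≤-trans
    (by-≤ (f zero) (solve 2 (λ x y → x :+ y :- y := x) ≈-refl (f zero) (sum (f ∘ suc))) (0≤f zero))
    Σ≤0) i

  maximum : ∀ {n} (f : Fin (ℕ.suc n) → ℝ) → DoubleNegation (∃[ i ] ∀ j → f j ≤ f i)
  maximum f = ¬¬-∀ (λ i → ¬¬-∀ λ j → trichotomy (f i) (f j)) >>= λ tri →
    case least {P = λ _ → Unit.⊤} {λ i j → f j ≤ f i} (λ _ → yes Unit.tt)
      (λ {i} {j} _ _ → case tri i j of λ where
        (inj₁ lt)        → inj₂ (<⇒≤ lt)
        (inj₂ (inj₁ eq)) → inj₁ (≈⇒≤ (≈-sym eq))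
        (inj₂ (inj₂ gt)) → inj₁ (<⇒≤ gt))
      (λ _ _ _ p q → ≤-trans q p) of λ where
    (inj₁ (i , _ , max)) → return (i , λ j → max j Unit.tt)
    (inj₂ none) → ⊥-elim (none zero Unit.tt)

  upper-bound : ∀ {n} (f : Fin n → ℝ) → DoubleNegation (∃[ m ] 0# < m × (∀ i → f i < m))
  -- With 0 prepended the family is never empty and its maximum is nonnegative, so adding 1 gives a
  -- positive bound.
  upper-bound {n} f = maximum 0∷f >>= λ (k , max) →
    ¬¬-∀ {n = ℕ.suc n} (λ i ¬lt → ≤-split (max i) λ where
      (inj₁ lt) → ¬lt (<-trans lt (step (0∷f k)))
      (inj₂ eq) → ¬lt (<-respˡ-≈ (≈-sym eq) (step (0∷f k)))) >>= λ below →
    return (0∷f k + 1# , below zero , below ∘ suc)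
    where
    0∷f : Fin (ℕ.suc n) → ℝ
    0∷f zero    = 0#
    0∷f (suc i) = f i
    step : ∀ x → x < x + 1#
    step x = by-< 1# (solve 2 (λ x o → x :+ o :- x := o) ≈-refl x 1#) 0<1

  -- The midpoint of the largest `l i` and the smallest `u j` works; `h` is one half.
  between : ∀ {n} (l u : Fin n → ℝ) → (∀ i j → l i < u j) →
            DoubleNegation (∃[ m ] (∀ i → l i < m) × (∀ i → m < u i))
  between {ℕ.zero}  l u l<u = return (0# , (λ ()) , λ ())
  between {ℕ.suc n} l u l<u =
    maximum l >>= λ (i , max) → maximum (-_ ∘ u) >>= λ (j , min) →
    inverse (0<+0< 0<1 0<1) >>= λ (h , 0<h , h*2≈1) →
    let m = h * (l i + u j)
        0<h*gap = *-pos 0<h (<⇒0< (l<u i j))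
        scale : ∀ x → x ≈ h * (1# + 1#) * x
        scale x = ≈-sym (≈-trans (*-cong h*2≈1 ≈-refl) (R.*-identityˡ x))
        double : ∀ x → x ≈ h * (x + x)
        double x = ≈-trans (scale x) (≈-trans
          (solve 3 (λ h o x → h :* (o :+ o) :* x := h :* (o :* x :+ o :* x)) ≈-refl h 1# x)
          (*-cong ≈-refl (+-cong (R.*-identityˡ x) (R.*-identityˡ x))))
        lᵢ<m : l i < m
        lᵢ<m = by-< (h * (u j - l i)) (≈-trans (+-cong ≈-refl (-‿cong (double (l i))))
          (solve 3 (λ h x y → h :* (x :+ y) :- h :* (x :+ x) := h :* (y :- x)) ≈-refl h (l i) (u j))) 0<h*gap
        m<uⱼ : m < u j
        m<uⱼ = by-< (h * (u j - l i)) (≈-trans (+-cong (double (u j)) ≈-refl)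
          (solve 3 (λ h x y → h :* (y :+ y) :- h :* (x :+ y) := h :* (y :- x)) ≈-refl h (l i) (u j))) 0<h*gap
        neg-≤ : ∀ {x y} → - x ≤ - y → y ≤ x
        neg-≤ {x} {y} p = by-≤ _ (solve 2 (λ x y → x :- y := (:- y) :- (:- x)) ≈-refl x y) (≤⇒0≤ p)
    in ¬¬-∀ (λ k ¬lt → ≤-split (max k) λ where
         (inj₁ lt) → ¬lt (<-trans lt lᵢ<m)
         (inj₂ eq) → ¬lt (<-respˡ-≈ (≈-sym eq) lᵢ<m)) >>= λ lower →
       ¬¬-∀ (λ k → <-≤-trans m<uⱼ (neg-≤ (min k))) >>= λ upper →
       return (m , lower , upper)

  -- A one-dimensional Farkas lemma: the strict inequalities `x * a i < b i` have a common solution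
  -- if no nontrivial nonnegative combination of two of them eliminates the unknown and leaves a
  -- false inequality.
  module _ {n} (a b : Fin n → ℝ)
    (compatible : ∀ i j {s t} → 0# ≤ s → 0# ≤ t → 0# < s + t → s * a i + t * a j ≈ 0# → ¬ (s * b i + t * b j ≤ 0#))
    where

    private
      -- According to the sign of `a i`, the inequality bounds `x` above by `q`, bounds it below by
      -- `q`, or holds for every `x`; here `q` is the quotient of `b i` by `a i`.
      data Slope (i : Fin n) : Set where
        pos  : ∀ q → 0# < a i → q * a i ≈ b i → Slope i
        neg  : ∀ q → a i < 0# → q * a i ≈ b i → Slope i
        flat : a i ≈ 0# → 0# < b i → Slope i

      0≤1 : 0# ≤ 1#
      0≤1 = <⇒≤ 0<1

      1*x+0*x≈x : ∀ x → 1# * x + 0# * x ≈ x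
      1*x+0*x≈x x = ≈-trans (+-cong (R.*-identityˡ x) (zeroˡ x)) (+-identityʳ x)

      slope : ∀ i → DoubleNegation (Slope i)
      slope i = trichotomy 0# (a i) >>= λ where
        (inj₁ 0<a) → inverse 0<a >>= λ (r , _ , eq) → return (pos (b i * r) 0<a
          (≈-trans (R.*-assoc _ _ _) (≈-trans (*-cong ≈-refl eq) (R.*-identityʳ _))))
        (inj₂ (inj₂ a<0)) → inverse (neg-pos a<0) >>= λ (r , _ , eq) → return (neg (- (b i * r)) a<0
          (≈-trans (solve 3 (λ b r a → (:- (b :* r)) :* a := b :* (r :* (:- a))) ≈-refl (b i) r (a i))
            (≈-trans (*-cong ≈-refl eq) (R.*-identityʳ _))))
        (inj₂ (inj₁ 0≈a)) → trichotomy 0# (b i) >>= λ where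
          (inj₁ 0<b) → return (flat (≈-sym 0≈a) 0<b)
          -- The weights 1 and 0 on the single index `i` contradict compatibility.
          (inj₂ b≤0) → ⊥-elim (compatible i i 0≤1 (<-irrefl ≈-refl)
            (<-respʳ-≈ (≈-sym (+-identityʳ 1#)) 0<1)
            (≈-trans (1*x+0*x≈x (a i)) (≈-sym 0≈a))
            (≤-resp-≈ (≈-sym (1*x+0*x≈x (b i))) ≈-refl
              ([ (λ 0≈b → ≈⇒≤ (≈-sym 0≈b)) , <⇒≤ ]′ b≤0)))

      -- The weights `a j` and `- a i` eliminate the unknown from a lower and an upper bound, as in
      -- Fourier-Motzkin elimination.
      cross : ∀ i j {qᵢ qⱼ} → a i < 0# → qᵢ * a i ≈ b i → 0# < a j → qⱼ * a j ≈ b j →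
              DoubleNegation (qᵢ < qⱼ)
      cross i j {qᵢ} {qⱼ} aᵢ<0 eqᵢ 0<aⱼ eqⱼ qⱼ≤qᵢ = compatible i j (<⇒≤ 0<aⱼ) (<⇒≤ 0<-aᵢ)
        (0<+0< 0<aⱼ 0<-aᵢ)
        (solve 2 (λ x y → y :* x :+ (:- x) :* y := con ℤ.0ℤ) ≈-refl (a i) (a j))
        (by-≤ (a j * - a i * (qᵢ - qⱼ))
          (≈-trans (+-cong ≈-refl (-‿cong (+-cong (*-cong ≈-refl (≈-sym eqᵢ)) (*-cong ≈-refl (≈-sym eqⱼ)))))
            (solve 4 (λ x y p q → con ℤ.0ℤ :- (y :* (p :* x) :+ (:- x) :* (q :* y)) := y :* (:- x) :* (p :- q))
              ≈-refl (a i) (a j) qᵢ qⱼ))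
          (0≤*0≤ (<⇒≤ (*-pos 0<aⱼ 0<-aᵢ)) (≤⇒0≤ qⱼ≤qᵢ)))
        where
        0<-aᵢ : 0# < - a i
        0<-aᵢ = neg-pos aᵢ<0

      -- `between` expects a lower and an upper bound from every index. A missing one is replaced by
      -- `- m` or `m`, which will be chosen beyond all the quotients.
      lower upper : ℝ → ∀ {i} → Slope i → ℝ
      lower m (neg q _ _) = q
      lower m _           = - m
      upper m (pos q _ _) = q
      upper m _           = m

      quotient : ∀ {i} → Slope i → ℝ
      quotient (pos q _ _) = q
      quotient (neg q _ _) = q
      quotient (flat _ _)  = 0#

      solves : ∀ {m m′ x i} (σ : Slope i) → lower m σ < x → x < upper m′ σ → x * a i < b i
      solves {x = x} {i} (pos q 0<a eq) _ x<q = <-respʳ-≈ eq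
        (by-< ((q - x) * a i) (solve 3 (λ q x a → q :* a :- x :* a := (q :- x) :* a) ≈-refl q x (a i))
          (*-pos (<⇒0< x<q) 0<a))
      solves {x = x} {i} (neg q a<0 eq) q<x _ = <-respʳ-≈ eq
        (by-< ((x - q) * - a i) (solve 3 (λ q x a → q :* a :- x :* a := (x :- q) :* (:- a)) ≈-refl q x (a i))
          (*-pos (<⇒0< q<x) (neg-pos a<0)))
      solves {x = x} (flat a≈0 0<b) _ _ = <-respˡ-≈ (≈-sym (≈-trans (*-cong ≈-refl a≈0) (zeroʳ x))) 0<b

      -<⇒-< : ∀ {x y} → - x < y → - y < x
      -<⇒-< {x} {y} p = by-< _ (solve 2 (λ x y → x :- (:- y) := y :- (:- x)) ≈-refl x y) (<⇒0< p)

      above : ∀ {m m′ j} (τ : Slope j) → 0# < m → 0# < m′ → - quotient τ < m → - m < upper m′ τ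
      above (pos _ _ _) _ _ -q<m = -<⇒-< -q<m
      above (neg _ _ _) 0<m 0<m′ _ = <-trans (-<⇒-< (<-respˡ-≈ (≈-sym RP.-0#≈0#) 0<m)) 0<m′
      above (flat _ _)  0<m 0<m′ _ = <-trans (-<⇒-< (<-respˡ-≈ (≈-sym RP.-0#≈0#) 0<m)) 0<m′

      gap : ∀ {m m′ i j} (σ : Slope i) (τ : Slope j) → 0# < m → 0# < m′ →
            - quotient τ < m → quotient σ < m′ → DoubleNegation (lower m σ < upper m′ τ)
      gap (neg q a<0 eq) (pos q′ 0<a eq′) _ _ _ _ = cross _ _ a<0 eq 0<a eq′
      gap (neg q _ _) (neg _ _ _) _ _ _ q<m′ = return q<m′
      gap (neg q _ _) (flat _ _)  _ _ _ q<m′ = return q<m′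
      gap (pos _ _ _) τ 0<m 0<m′ -q<m _ = return (above τ 0<m 0<m′ -q<m)
      gap (flat _ _) τ 0<m 0<m′ -q<m _ = return (above τ 0<m 0<m′ -q<m)

    solvable : DoubleNegation (∃[ x ] ∀ i → x * a i < b i)
    solvable =
      ¬¬-∀ slope >>= λ σ →
      upper-bound (λ i → - quotient (σ i)) >>= λ (m , 0<m , -q<m) →
      upper-bound (λ i → quotient (σ i)) >>= λ (m′ , 0<m′ , q<m′) →
      ¬¬-∀ (λ i → ¬¬-∀ λ j → gap (σ i) (σ j) 0<m 0<m′ (-q<m j) (q<m′ i)) >>= λ l<u →
      between (λ i → lower m (σ i)) (λ i → upper m′ (σ i)) l<u >>= λ (x , l<x , x<u) →
      return (x , λ i → solves (σ i) (l<x i) (x<u i))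

-- Hulls and separating lines

module Hull (𝓡 : RealNumbers) {n : ℕ} (S : Plane.ColouredPointSet 𝓡 n) where
  open RealNumbers 𝓡
  open HeytingField heytingField using (_-_; -_; setoid)
  open CommutativeRing commutativeRing
    using (+-cong; *-cong; -‿cong; +-identityˡ; +-identityʳ; zeroˡ; zeroʳ; *-identityˡ; *-identityʳ)
    renaming (refl to ≈-refl; sym to ≈-sym; trans to ≈-trans)
  open IsStrictPartialOrder isStrictPartialOrder
    using (<-respʳ-≈) renaming (irrefl to <-irrefl; trans to <-trans; asym to <-asym)
  open OrderedField 𝓡
  open Solver using (solve; _:=_; _:+_; _:*_; _:-_; :-_; con)
  open Σ using (sum-cong-≋; ∑-distrib-+; *-distribˡ-sum; sum-replicate-zero)
  open Plane 𝓡
  open ColouredPointSet S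
  open import Relation.Binary.Reasoning.Setoid setoid

  Hull : Subset n → Point → Set
  Hull = ConvexHull S

  private
    X Y : Fin n → ℝ
    X = proj₁ ∘ point
    Y = proj₂ ∘ point

  sum-linear : ∀ {m} s t (f g : Fin m → ℝ) → sum (λ i → s * f i + t * g i) ≈ s * sum f + t * sum g
  sum-linear s t f g = ≈-trans (∑-distrib-+ (λ i → s * f i) (λ i → t * g i))
    (+-cong (≈-sym (*-distribˡ-sum s f)) (≈-sym (*-distribˡ-sum t g)))

  hull-resp-≈ : ∀ {Z p q} → p ≈ₚ q → Hull Z p → Hull Z q
  hull-resp-≈ (x≈ , y≈) (w , 0≤w , w-supp , Σw≈1 , px , py) =
    w , 0≤w , w-supp , Σw≈1 , ≈-trans (≈-sym x≈) px , ≈-trans (≈-sym y≈) py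

  hull-combination : ∀ {Z p q s t} → Hull Z p → Hull Z q → s ≥ 0# → t ≥ 0# → s + t ≈ 1# →
                     Hull Z (combination s p t q)
  hull-combination {s = s} {t} (w , 0≤w , w-supp , Σw≈1 , px , py) (v , 0≤v , v-supp , Σv≈1 , qx , qy) 0≤s 0≤t s+t≈1 =
    (λ i → s * w i + t * v i) ,
    (λ i → 0≤+0≤ (0≤*0≤ 0≤s (0≤w i)) (0≤*0≤ 0≤t (0≤v i))) ,
    (λ i i∉Z → ≈-trans (+-cong (*-cong ≈-refl (w-supp i i∉Z)) (*-cong ≈-refl (v-supp i i∉Z)))
      (≈-trans (+-cong (zeroʳ s) (zeroʳ t)) (+-identityˡ 0#))) ,
    ≈-trans (sum-linear s t w v) (≈-trans (+-cong (*-cong ≈-refl Σw≈1) (*-cong ≈-refl Σv≈1))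
      (≈-trans (+-cong (*-identityʳ s) (*-identityʳ t)) s+t≈1)) ,
    coordinate X px qx , coordinate Y py qy
    where
    coordinate : ∀ (f : Fin n → ℝ) {x y} → x ≈ sum (λ i → w i * f i) → y ≈ sum (λ i → v i * f i) →
                 s * x + t * y ≈ sum (λ i → (s * w i + t * v i) * f i)
    coordinate f {x} {y} eqx eqy = begin
      s * x + t * y ≈⟨ +-cong (*-cong ≈-refl eqx) (*-cong ≈-refl eqy) ⟩
      s * sum (λ i → w i * f i) + t * sum (λ i → v i * f i) ≈⟨ sum-linear s t (λ i → w i * f i) (λ i → v i * f i) ⟨
      sum (λ i → s * (w i * f i) + t * (v i * f i)) ≈⟨ sum-cong-≋ (λ i →
        solve 5 (λ s w t v f → s :* (w :* f) :+ t :* (v :* f) := (s :* w :+ t :* v) :* f) ≈-refl s (w i) t (v i) (f i)) ⟩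
      sum (λ i → (s * w i + t * v i) * f i) ∎

  δ : ∀ {m} → Fin m → Fin m → ℝ
  δ zero    zero    = 1#
  δ zero    (suc j) = 0#
  δ (suc i) zero    = 0#
  δ (suc i) (suc j) = δ i j

  sum-δ : ∀ {m} (i : Fin m) (f : Fin m → ℝ) → f i ≈ sum (λ j → δ i j * f j)
  sum-δ {ℕ.suc m} zero f = ≈-sym (≈-trans (+-cong (*-identityˡ _)
    (≈-trans (sum-cong-≋ (λ j → zeroˡ (f (suc j)))) (sum-replicate-zero m))) (+-identityʳ _))
  sum-δ (suc i) f = ≈-sym (≈-trans (+-cong (zeroˡ _) (≈-sym (sum-δ i (f ∘ suc)))) (+-identityˡ _))

  δ-0≤ : ∀ {m} (i j : Fin m) → 0# ≤ δ i j
  δ-0≤ zero    zero    = <⇒≤ 0<1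
  δ-0≤ zero    (suc j) = <-irrefl ≈-refl
  δ-0≤ (suc i) zero    = <-irrefl ≈-refl
  δ-0≤ (suc i) (suc j) = δ-0≤ i j

  δ-off : ∀ {m} (i j : Fin m) → i ≢ j → δ i j ≈ 0#
  δ-off zero    zero    i≢j = contradiction ≡.refl i≢j
  δ-off zero    (suc j) i≢j = ≈-refl
  δ-off (suc i) zero    i≢j = ≈-refl
  δ-off (suc i) (suc j) i≢j = δ-off i j (i≢j ∘ ≡.cong suc)

  hull-point : ∀ {Z i} → i ∈ Z → Hull Z (point i)
  hull-point {Z} {i} i∈Z = δ i , δ-0≤ i , (λ j j∉Z → δ-off i j λ { ≡.refl → j∉Z i∈Z }) ,
    ≈-sym (≈-trans (sum-δ i (λ _ → 1#)) (sum-cong-≋ (λ j → *-identityʳ (δ i j)))) ,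
    sum-δ i X , sum-δ i Y

  private
    -- An affine function takes at a convex combination the average of its values; that the weights
    -- sum to 1 accounts for the constant term.
    excess : ∀ {p Z} a b c (h : Hull Z p) → let w = proj₁ h in
             sum (λ i → w i * (c - (a * X i + b * Y i))) ≈ c - (a * proj₁ p + b * proj₂ p)
    excess {x , y} a b c (w , _ , _ , Σw≈1 , px , py) = begin
      sum (λ i → w i * (c - (a * X i + b * Y i)))
        ≈⟨ sum-cong-≋ (λ i → solve 6 (λ w a b c x y →
             w :* (c :- (a :* x :+ b :* y)) := c :* w :+ (:- con 1ℤ) :* (a :* (w :* x) :+ b :* (w :* y)))
             ≈-refl (w i) a b c (X i) (Y i)) ⟩
      sum (λ i → c * w i + m * (a * (w i * X i) + b * (w i * Y i)))
        ≈⟨ sum-linear c m w (λ i → a * (w i * X i) + b * (w i * Y i)) ⟩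
      c * sum w + m * sum (λ i → a * (w i * X i) + b * (w i * Y i))
        ≈⟨ +-cong (*-cong ≈-refl Σw≈1) (*-cong ≈-refl (≈-trans (sum-linear a b (λ i → w i * X i) (λ i → w i * Y i))
             (+-cong (*-cong ≈-refl (≈-sym px)) (*-cong ≈-refl (≈-sym py))))) ⟩
      c * 1# + m * (a * x + b * y)
        ≈⟨ +-cong (*-identityʳ c) ≈-refl ⟩
      c + m * (a * x + b * y)
        ≈⟨ solve 2 (λ c z → c :+ (:- con 1ℤ) :* z := c :- z) ≈-refl c (a * x + b * y) ⟩
      c - (a * x + b * y) ∎
      where
      -- `1# + 0#` is the value of `con 1ℤ` in the ring solver.
      m = - (1# + 0#)

  hull-≤ : ∀ {Z p} a b c → (∀ i → i ∈ Z → a * X i + b * Y i ≤ c) → Hull Z p →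
           a * proj₁ p + b * proj₂ p ≤ c
  hull-≤ {Z} a b c below h@(w , 0≤w , w-supp , _) = by-≤ _ (≈-sym (excess a b c h)) (sum-0≤ λ i →
    case i ∈? Z of λ where
      (yes i∈Z) → 0≤*0≤ (0≤w i) (≤⇒0≤ (below i i∈Z))
      (no i∉Z)  → ≈⇒≤ (≈-sym (≈-trans (*-cong (w-supp i i∉Z) ≈-refl) (zeroˡ _))))

  -- If the average excess were at most 0, all its nonnegative terms would vanish; the excess is
  -- positive on `Z`, so all weights would be 0 although they sum to 1. Strict inequalities are
  -- phrased as negations, which are stable under double negation.
  hull-≱ : ∀ {Z p} a b c → (∀ i → i ∈ Z → ¬ (c ≤ a * X i + b * Y i)) → Hull Z p →
           ¬ (c ≤ a * proj₁ p + b * proj₂ p)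
  hull-≱ {Z} a b c below h@(w , 0≤w , w-supp , Σw≈1 , _) c≤ =
    <-irrefl (≈-sym (≈-trans (sum-cong-≋ w≈0) (sum-replicate-zero n))) (<-respʳ-≈ (≈-sym Σw≈1) 0<1)
    where
    excess≤0 : sum (λ i → w i * (c - (a * X i + b * Y i))) ≤ 0#
    excess≤0 = by-≤ _ (≈-trans (+-cong ≈-refl (-‿cong (excess a b c h)))
      (solve 2 (λ c z → con 0ℤ :- (c :- z) := z :- c) ≈-refl c _)) (≤⇒0≤ c≤)
    0≤excess : ∀ i → i ∈ Z → 0# ≤ c - (a * X i + b * Y i)
    0≤excess i i∈Z = ≤⇒0≤ λ c< → below i i∈Z (<⇒≤ c<)
    0≤term : ∀ i → 0# ≤ w i * (c - (a * X i + b * Y i))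
    0≤term i = case i ∈? Z of λ where
      (yes i∈Z) → 0≤*0≤ (0≤w i) (0≤excess i i∈Z)
      (no i∉Z)  → ≈⇒≤ (≈-sym (≈-trans (*-cong (w-supp i i∉Z) ≈-refl) (zeroˡ _)))
    w≈0 : ∀ i → w i ≈ 0#
    w≈0 i with i ∈? Z
    ... | no i∉Z  = w-supp i i∉Z
    ... | yes i∈Z = ≤-antisym
      (λ 0<w → trichotomy c (a * X i + b * Y i) λ where
        (inj₁ c<)        → below i i∈Z (<⇒≤ c<)
        (inj₂ (inj₁ c≈)) → below i i∈Z (≈⇒≤ c≈)
        (inj₂ (inj₂ <c)) → sum≤0⇒≤0 0≤term excess≤0 i (*-pos 0<w (<⇒0< <c)))
      (0≤w i)

  hull-≰ : ∀ {Z p} a b c → (∀ i → i ∈ Z → ¬ (a * X i + b * Y i ≤ c)) → Hull Z p →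
           ¬ (a * proj₁ p + b * proj₂ p ≤ c)
  hull-≰ a b c above h ≤c = hull-≱ (- a) (- b) (- c) (λ i i∈Z -c≤ → above i i∈Z (by-≤ _ (negated (X i) (Y i)) (≤⇒0≤ -c≤))) h
    (by-≤ _ (≈-sym (negated _ _)) (≤⇒0≤ ≤c))
    where
    negated : ∀ x y → c - (a * x + b * y) ≈ - a * x + - b * y - - c
    negated = solve 5 (λ a b c x y → c :- (a :* x :+ b :* y) := (:- a) :* x :+ (:- b) :* y :- (:- c)) ≈-refl a b c

  -- The solver evaluates `con 1ℤ` to `1# + 0#` rather than `1#`; with this value as a coefficient,
  -- identities about `height` can be solved directly.
  one : ℝ
  one = ι 1ℤ

  0<one : 0# < one
  0<one = <-respʳ-≈ (≈-sym (+-identityʳ 1#)) 0<1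

  -- The intercept on the vertical axis of the line of slope `α` through the point.
  height : ℝ → Point → ℝ
  height α (x , y) = - α * x + one * y

  -- Z lies strictly below and Z′ strictly above the line y = α x + β.
  record _Below_ (Z Z′ : Subset n) : Set where
    field
      α β   : ℝ
      below : ∀ i → i ∈ Z  → height α (point i) < β
      above : ∀ i → i ∈ Z′ → β < height α (point i)

  -- The obstruction to `Z Below Z′`; by `below⇒¬overhangs` and `separate` it is the only one for
  -- nonempty sets, up to double negation.
  Overhangs : Subset n → Subset n → Set
  Overhangs Z Z′ = ∃[ p ] ∃[ q ] Hull Z p × Hull Z′ q × proj₁ p ≈ proj₁ q × proj₂ q ≤ proj₂ p

  Disjoint : Subset n → Subset n → Set
  Disjoint Z Z′ = ∀ p → ¬ (Hull Z p × Hull Z′ p)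

  hull-below : ∀ {Z Z′} (s : Z Below Z′) → let open _Below_ s in ∀ {p} → Hull Z p → ¬ (β ≤ height α p)
  hull-below s = hull-≱ (- α) one β (λ i i∈Z β≤ → β≤ (below i i∈Z))
    where open _Below_ s

  hull-above : ∀ {Z Z′} (s : Z Below Z′) → let open _Below_ s in ∀ {p} → Hull Z′ p → ¬ (height α p ≤ β)
  hull-above s {x , y} h ≤β = hull-≱ α (- one) (- β) (λ i i∈Z β≤ → β≤ (by-< _ (negated (X i) (Y i)) (<⇒0< (above i i∈Z)))) h
    (by-≤ _ (solve 4 (λ α β x y → α :* x :+ (:- con 1ℤ) :* y :- (:- β) := β :- ((:- α) :* x :+ con 1ℤ :* y)) ≈-refl α β x y)
      (≤⇒0≤ ≤β))
    where
    open _Below_ s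
    negated : ∀ x y → - β - (α * x + - one * y) ≈ height α (x , y) - β
    negated = solve 4 (λ α β x y → (:- β) :- (α :* x :+ (:- con 1ℤ) :* y) := (:- α) :* x :+ con 1ℤ :* y :- β) ≈-refl α β

  height-mono : ∀ α {p q} → proj₁ p ≈ proj₁ q → proj₂ q ≤ proj₂ p → height α q ≤ height α p
  height-mono α {x , y} {x′ , y′} x≈x′ y′≤y = by-≤ (y - y′)
    (≈-trans (+-cong (+-cong (*-cong ≈-refl x≈x′) ≈-refl) ≈-refl)
      (solve 4 (λ α x y z → (:- α) :* x :+ con 1ℤ :* y :- ((:- α) :* x :+ con 1ℤ :* z) := y :- z) ≈-refl α x′ y y′))
    (≤⇒0≤ y′≤y)

  below⇒¬overhangs : ∀ {Z Z′} → Z Below Z′ → ¬ Overhangs Z Z′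
  below⇒¬overhangs s (p , q , hp , hq , x≈ , y≤) = hull-below s hp λ lt → hull-above s hq λ gt →
    height-mono α x≈ y≤ (<-trans lt gt)
    where open _Below_ s

  -- On one vertical line `Z` is on top, on another `Z′`. If each pair of points is weighted by the
  -- gap of the other pair, the two convex combinations coincide and give a common point of the
  -- hulls.
  ¬overhangs-both : ∀ {Z Z′} → Disjoint Z Z′ → Overhangs Z Z′ → ¬ Overhangs Z′ Z
  ¬overhangs-both disjoint (p , q , hp , hq , x≈ , y≤) (q′ , p′ , hq′ , hp′ , x′≈ , y′≤) =
    ≤-split (0≤+0≤ (≤⇒0≤ y≤) (≤⇒0≤ y′≤)) λ where
      -- If both gaps vanish, `p` and `q` already coincide.
      (inj₂ 0≈gaps) → disjoint p (hp , hull-resp-≈ (≈-sym x≈ , ≤-antisym y≤ (by-≤ (proj₂ q′ - proj₂ p′)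
        (≈-trans (solve 3 (λ q p d → q :- p := d :- (p :- q :+ d)) ≈-refl (proj₂ q) (proj₂ p) (proj₂ q′ - proj₂ p′))
          (≈-trans (+-cong ≈-refl (-‿cong (≈-sym 0≈gaps))) (solve 1 (λ d → d :- con 0ℤ := d) ≈-refl _)))
        (≤⇒0≤ y′≤))) hq)
      (inj₁ 0<gaps) → normalise (≤⇒0≤ y′≤) (≤⇒0≤ y≤) (<-respʳ-≈ (R.+-comm _ _) 0<gaps) λ where
        (r , _ , 0≤s , 0≤t , s+t≈1) → disjoint _
          ( hull-combination hp hp′ 0≤s 0≤t s+t≈1
          , hull-resp-≈
              ( +-cong (*-cong ≈-refl (≈-sym x≈)) (*-cong ≈-refl x′≈)
              , solve 5 (λ r a b c d → r :* (c :- d) :* b :+ r :* (a :- b) :* c := r :* (c :- d) :* a :+ r :* (a :- b) :* d)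
                  ≈-refl r (proj₂ p) (proj₂ q) (proj₂ q′) (proj₂ p′))
              (hull-combination hq hq′ 0≤s 0≤t s+t≈1))

  x-y≈0⇒x≈y : ∀ {x y} → x - y ≈ 0# → x ≈ y
  x-y≈0⇒x≈y {x} {y} eq = ≈-trans (solve 2 (λ x y → x := x :- y :+ y) ≈-refl x y)
    (≈-trans (+-cong eq ≈-refl) (+-identityˡ y))

  private
    -- Indices outside `Z` are sent to a fixed element, so that families over `Z` can be indexed by
    -- all of `Fin n`.
    retract : ∀ {Z} → Nonempty Z → Fin n → ∃[ i ] i ∈ Z
    retract {Z} (i₀ , i₀∈Z) i with i ∈? Z
    ... | yes i∈Z = i , i∈Z
    ... | no  _   = i₀ , i₀∈Z

    retract-id : ∀ {Z} (ne : Nonempty Z) {i} → i ∈ Z → proj₁ (retract ne i) ≡ i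
    retract-id {Z} ne {i} i∈Z with i ∈? Z
    ... | yes _   = ≡.refl
    ... | no  i∉Z = contradiction i∈Z i∉Z

  -- The slopes of the lines with Z below and Z′ above are cut out by one
  -- linear condition for each pair in Z × Z′, and two conditions that clash
  -- exhibit points of the hulls in the wrong order.
  separate : ∀ {Z Z′} → Nonempty Z → Nonempty Z′ → ¬ Overhangs Z Z′ → DoubleNegation (Z Below Z′)
  separate {Z} {Z′} ne ne′ ¬overhangs =
    solvable a b compatible >>= λ (α , α-solves) →
    between (λ i → height α (point (P i))) (λ j → height α (point (Q j))) (ordered α α-solves) >>= λ (β , lower , upper) →
    return record
      { α = α ; β = β
      ; below = λ i i∈Z  → ≡.subst (λ i → height α (point i) < β) (retract-id ne i∈Z) (lower i)
      ; above = λ i i∈Z′ → ≡.subst (λ i → β < height α (point i)) (retract-id ne′ i∈Z′) (upper i)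
      }
    where
    P Q : Fin n → Fin n
    P = proj₁ ∘ retract ne
    Q = proj₁ ∘ retract ne′
    left right : Fin (n ℕ.* n) → Fin n
    left k  = P (proj₁ (remQuot {n} n k))
    right k = Q (proj₂ (remQuot {n} n k))
    a b : Fin (n ℕ.* n) → ℝ
    a k = X (right k) - X (left k)
    b k = Y (right k) - Y (left k)
    hull-left : ∀ k → Hull Z (point (left k))
    hull-left k = hull-point (proj₂ (retract ne (proj₁ (remQuot {n} n k))))
    hull-right : ∀ k → Hull Z′ (point (right k))
    hull-right k = hull-point (proj₂ (retract ne′ (proj₂ (remQuot {n} n k))))
    weighted : ∀ r s t u v x y → r * s * u + r * t * v - (r * s * x + r * t * y) ≈ r * (s * (u - x) + t * (v - y))
    weighted = solve 7 (λ r s t u v x y → r :* s :* u :+ r :* t :* v :- (r :* s :* x :+ r :* t :* y)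
      := r :* (s :* (u :- x) :+ t :* (v :- y))) ≈-refl
    compatible : ∀ i j {s t} → 0# ≤ s → 0# ≤ t → 0# < s + t → s * a i + t * a j ≈ 0# → ¬ (s * b i + t * b j ≤ 0#)
    compatible i j {s} {t} 0≤s 0≤t 0<s+t a≈0 b≤0 = normalise 0≤s 0≤t 0<s+t λ where
      (r , 0<r , 0≤rs , 0≤rt , r≈1) → ¬overhangs
        ( _ , _
        , hull-combination (hull-left i) (hull-left j) 0≤rs 0≤rt r≈1
        , hull-combination (hull-right i) (hull-right j) 0≤rs 0≤rt r≈1
        , ≈-sym (x-y≈0⇒x≈y (≈-trans (weighted r s t (X (right i)) (X (right j)) (X (left i)) (X (left j)))
            (≈-trans (*-cong ≈-refl a≈0) (zeroʳ r))))
        , by-≤ (r * - (s * b i + t * b j))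
            (solve 7 (λ r s t u v x y → r :* s :* x :+ r :* t :* y :- (r :* s :* u :+ r :* t :* v)
              := r :* (:- (s :* (u :- x) :+ t :* (v :- y)))) ≈-refl
              r s t (Y (right i)) (Y (right j)) (Y (left i)) (Y (left j)))
            (0≤*0≤ (<⇒≤ 0<r) (≤-resp-≈ ≈-refl (+-identityˡ _) (≤⇒0≤ b≤0))) )
    ordered : ∀ α → (∀ k → α * a k < b k) → ∀ i j → height α (point (P i)) < height α (point (Q j))
    ordered α α-solves i j = by-< (Y (Q j) - Y (P i) - α * (X (Q j) - X (P i)))
      (solve 5 (λ α x y u v → (:- α) :* u :+ con 1ℤ :* v :- ((:- α) :* x :+ con 1ℤ :* y) := v :- y :- α :* (u :- x))
        ≈-refl α (X (P i)) (Y (P i)) (X (Q j)) (Y (Q j)))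
      (<⇒0< (≡.subst (λ (i , j) → α * (X (Q j) - X (P i)) < Y (Q j) - Y (P i))
        (remQuot-combine {n} {n} i j) (α-solves (combine i j))))

  -- Disjoint hulls overhang each other in at most one direction, and in a direction without
  -- overhang there is a separating line.
  separation : ∀ {Z Z′} → Nonempty Z → Nonempty Z′ → Disjoint Z Z′ → DoubleNegation (Z Below Z′ ⊎ Z′ Below Z)
  separation {Z} {Z′} ne ne′ disjoint = ¬¬-excluded-middle >>= λ where
    (no ¬overhangs) → separate ne ne′ ¬overhangs >>= λ s → return (inj₁ s)
    (yes overhangs) → separate ne′ ne (¬overhangs-both disjoint overhangs) >>= λ s → return (inj₂ s)

  -- Each end point is weighted by the distance of the other one from `x`. The case where `X i`
  -- equals `x` is treated apart, so that the sum of the weights is positive.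
  hull-meets-vertical : ∀ {Z i j x} → i ∈ Z → j ∈ Z → X i ≤ x → x ≤ X j →
                        DoubleNegation (∃[ y ] Hull Z (x , y))
  hull-meets-vertical {i = i} {j} {x} i∈Z j∈Z Xᵢ≤x x≤Xⱼ = ≤-split Xᵢ≤x >>= λ where
    (inj₂ Xᵢ≈x) → return (Y i , hull-resp-≈ (Xᵢ≈x , ≈-refl) (hull-point i∈Z))
    (inj₁ Xᵢ<x) → let 0<gap = <⇒0< Xᵢ<x in
      <-≤-trans 0<gap (by-≤ (X j - x)
        (solve 3 (λ i j x → j :- x :+ (x :- i) :- (x :- i) := j :- x) ≈-refl (X i) (X j) x) (≤⇒0≤ x≤Xⱼ)) >>= λ 0<sum →
      normalise (≤⇒0≤ x≤Xⱼ) (<⇒≤ 0<gap) 0<sum >>= λ where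
        (r , _ , 0≤s , 0≤t , s+t≈1) → return (_ , hull-resp-≈
          ( ≈-trans (solve 4 (λ r i j x → r :* (j :- x) :* i :+ r :* (x :- i) :* j := (r :* (j :- x) :+ r :* (x :- i)) :* x)
              ≈-refl r (X i) (X j) x)
              (≈-trans (*-cong s+t≈1 ≈-refl) (*-identityˡ x))
          , ≈-refl)
          (hull-combination (hull-point i∈Z) (hull-point j∈Z) 0≤s 0≤t s+t≈1))

-- Weights of coloured sets and of wedges.

∣+m-+n∣ : ∀ m n → ℕ.∣ m - n ∣ ≡ ℤ.∣ ℤ.+ m ℤ.- ℤ.+ n ∣
∣+m-+n∣ m n = ≡.trans (go m n) (cong ℤ.∣_∣ (≡.sym (ℤₚ.[+m]-[+n]≡m⊖n m n)))
  where
  go : ∀ m n → ℕ.∣ m - n ∣ ≡ ℤ.∣ m ℤ.⊖ n ∣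
  go ℕ.zero    ℕ.zero    = refl
  go ℕ.zero    (ℕ.suc n) = refl
  go (ℕ.suc m) ℕ.zero    = refl
  go (ℕ.suc m) (ℕ.suc n) = ≡.trans (go m n) (cong ℤ.∣_∣ (≡.sym (ℤₚ.[1+m]⊖[1+n]≡m⊖n m n)))

colour : ∀ {n} → Subset n → Subset n → Fin n → ℤ
colour R B p = χ (lookup R p) ℤ.- χ (lookup B p)

opaque
  unfolding weight

  weight-colour : ∀ {n} (Z R B : Subset n) →
                  ℤ.+ ∣ Z ∩ R ∣ ℤ.- ℤ.+ ∣ Z ∩ B ∣ ≡ weight (colour R B) (lookup Z)
  weight-colour [] [] [] = refl
  weight-colour (z ∷ Z) (r ∷ R) (b ∷ B) = begin
    ℤ.+ ∣ (z ∷ Z) ∩ (r ∷ R) ∣ ℤ.- ℤ.+ ∣ (z ∷ Z) ∩ (b ∷ B) ∣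
      ≡⟨ cong₂ ℤ._-_ (split z r (Z ∩ R)) (split z b (Z ∩ B)) ⟩
    (χ z ℤ.* χ r ℤ.+ ℤ.+ ∣ Z ∩ R ∣) ℤ.- (χ z ℤ.* χ b ℤ.+ ℤ.+ ∣ Z ∩ B ∣)
      ≡⟨ rearrange (χ z) (χ r) (χ b) (ℤ.+ ∣ Z ∩ R ∣) (ℤ.+ ∣ Z ∩ B ∣) ⟩
    χ z ℤ.* (χ r ℤ.- χ b) ℤ.+ (ℤ.+ ∣ Z ∩ R ∣ ℤ.- ℤ.+ ∣ Z ∩ B ∣)
      ≡⟨ cong (λ i → χ z ℤ.* (χ r ℤ.- χ b) ℤ.+ i) (weight-colour Z R B) ⟩
    weight (colour (r ∷ R) (b ∷ B)) (lookup (z ∷ Z)) ∎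
    where
    open ≡.≡-Reasoning
    rearrange : ∀ z r b x y → (z ℤ.* r ℤ.+ x) ℤ.- (z ℤ.* b ℤ.+ y) ≡ z ℤ.* (r ℤ.- b) ℤ.+ (x ℤ.- y)
    rearrange = ℤ-Solver.solve-∀
    split : ∀ {n} z r (Y : Subset n) → ℤ.+ ∣ (z ∧ r) ∷ Y ∣ ≡ χ z ℤ.* χ r ℤ.+ ℤ.+ ∣ Y ∣
    split true  true  Y = refl
    split true  false Y = ≡.sym (ℤₚ.+-identityˡ _)
    split false r     Y = ≡.sym (ℤₚ.+-identityˡ _)

module Region (𝓡 : RealNumbers) {n : ℕ} (S : Plane.ColouredPointSet 𝓡 n) where
  open RealNumbers 𝓡
  open HeytingField heytingField using (_-_; -_)
  open CommutativeRing commutativeRing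
    using (+-cong; *-cong; +-identityˡ; *-identityˡ)
    renaming (refl to ≈-refl; sym to ≈-sym; trans to ≈-trans)
  open IsStrictPartialOrder isStrictPartialOrder
    using (<-respʳ-≈) renaming (irrefl to <-irrefl; trans to <-trans)
  open OrderedField 𝓡
  open Solver using (solve; _:=_; _:+_; _:*_; _:-_; :-_; con)
  open Plane 𝓡
  open ColouredPointSet S

  ω : Fin n → ℤ
  ω = colour R B

  disc≡∣weight∣ : ∀ Z → disc S Z ≡ ℤ.∣ weight ω (lookup Z) ∣
  disc≡∣weight∣ Z = ≡.trans (∣+m-+n∣ ∣ Z ∩ R ∣ ∣ Z ∩ B ∣) (cong ℤ.∣_∣ (weight-colour Z R B))

  disc-tabulate : ∀ b → disc S (tabulate b) ≡ ℤ.∣ weight ω b ∣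
  disc-tabulate b = ≡.trans (disc≡∣weight∣ (tabulate b)) (cong ℤ.∣_∣ (weight-cong ω (lookup∘tabulate b)))

  ∈-tabulate⁺ : ∀ {b : Fin n → Bool} {p} → b p ≡ true → p ∈ tabulate b
  ∈-tabulate⁺ {b} {p} eq = lookup⇒[]= p (tabulate b) (≡.trans (lookup∘tabulate b p) eq)

  ∈-tabulate⁻ : ∀ {b : Fin n → Bool} {p} → p ∈ tabulate b → b p ≡ true
  ∈-tabulate⁻ {b} {p} p∈ = ≡.trans (≡.sym (lookup∘tabulate b p)) ([]=⇒lookup p∈)

  private
    value : Coefficients → Point → ℝ
    value h (x , y) = let open Coefficients h in a * x + b * y

    value-cong : ∀ h {p q} → p ≈ₚ q → value h p ≈ value h q
    value-cong h (x≈ , y≈) = +-cong (*-cong ≈-refl x≈) (*-cong ≈-refl y≈)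

    value-combination : ∀ h → let open Coefficients h in ∀ {p q s t} → s + t ≈ 1# →
      c - value h (combination s p t q) ≈ s * (c - value h p) + t * (c - value h q)
    value-combination h {x , y} {x′ , y′} {s} {t} s+t≈1 = ≈-trans
      (+-cong (≈-trans (≈-sym (*-identityˡ c)) (*-cong (≈-sym s+t≈1) ≈-refl)) ≈-refl)
      (solve 9 (λ a b c x y x′ y′ s t →
        (s :+ t) :* c :- (a :* (s :* x :+ t :* x′) :+ b :* (s :* y :+ t :* y′)) :=
        s :* (c :- (a :* x :+ b :* y)) :+ t :* (c :- (a :* x′ :+ b :* y′))) ≈-refl a b c x y x′ y′ s t)
      where open Coefficients h

  halfPlane-convex : ∀ h → IsConvex (HalfPlane h)
  halfPlane-convex h = record
    { respects-≈ = λ p≈q → ≤-resp-≈ (value-cong h p≈q) ≈-refl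
    ; convex = λ p∈ q∈ 0≤s 0≤t s+t≈1 → by-≤ _ (value-combination h s+t≈1)
        (0≤+0≤ (0≤*0≤ 0≤s (≤⇒0≤ p∈)) (0≤*0≤ 0≤t (≤⇒0≤ q∈)))
    }

  ¬halfPlane-convex : ∀ h → IsConvex (¬_ ∘ HalfPlane h)
  ¬halfPlane-convex h = record
    { respects-≈ = λ p≈q p∉ q∈ → p∉ (≤-resp-≈ (≈-sym (value-cong h p≈q)) ≈-refl q∈)
    ; convex = λ {p} {q} p∉ q∉ {s} {t} 0≤s 0≤t s+t≈1 comb∈ →
        p∉ λ c<p → q∉ λ c<q → positive 0≤s 0≤t s+t≈1 (<⇒0< c<p) (<⇒0< c<q)
          (by-≤ _ (≈-trans (solve 5 (λ c u v s t →
              con 0ℤ :- (s :* (u :- c) :+ t :* (v :- c)) := s :* (c :- u) :+ t :* (c :- v)) ≈-refl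
              (Coefficients.c h) (value h p) (value h q) s t)
            (≈-sym (value-combination h s+t≈1))) (≤⇒0≤ comb∈))
    }
    where
    positive : ∀ {s t u v} → s ≥ 0# → t ≥ 0# → s + t ≈ 1# → 0# < u → 0# < v → ¬ (s * u + t * v ≤ 0#)
    -- Since `s + t ≈ 1#`, either `s` is positive or `t` equals 1, and the corresponding term is
    -- positive.
    positive {s} {t} {u} {v} 0≤s 0≤t s+t≈1 0<u 0<v ≤0 = ≤-split 0≤s λ where
      (inj₁ 0<s) → ≤-trans (by-≤ (t * v) (solve 2 (λ x y → x :+ y :- x := y) ≈-refl (s * u) (t * v))
        (0≤*0≤ 0≤t (<⇒≤ 0<v))) ≤0 (*-pos 0<s 0<u)
      (inj₂ 0≈s) → ≤-trans (by-≤ (s * u) (solve 2 (λ x y → x :+ y :- y := x) ≈-refl (s * u) (t * v))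
        (0≤*0≤ 0≤s (<⇒≤ 0<u))) ≤0
        (*-pos (<-respʳ-≈ (≈-trans (≈-sym s+t≈1) (≈-trans (+-cong (≈-sym 0≈s) ≈-refl) (+-identityˡ t))) 0<1) 0<v)

  ⋂-convex : {I : Set} {C : I → Point → Set} → (∀ i → IsConvex (C i)) → IsConvex (λ p → ∀ i → C i p)
  ⋂-convex conv = record
    { respects-≈ = λ p≈q p∈ i → IsConvex.respects-≈ (conv i) p≈q (p∈ i)
    ; convex = λ p∈ q∈ 0≤s 0≤t s+t≈1 i → IsConvex.convex (conv i) (p∈ i) (q∈ i) 0≤s 0≤t s+t≈1
    }

  module _ {D : ℕ} (maximal : ∀ (I : SeparableIsland S 2) → disc S (proj₁ I) ℕ.≤ D) where

    -- The maximality of `D` among separable islands enters the argument here; taking `G` equal to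
    -- `H` gives the bound for half-planes.
    wedge-bound : ∀ b G H → (∀ p → b p ≡ true ⇔ (HalfPlane G (point p) × HalfPlane H (point p))) →
                  ℤ.∣ weight ω b ∣ ℕ.≤ D
    wedge-bound b G H b⇔ = ≡.subst (ℕ._≤ D) (disc-tabulate b)
      (maximal (tabulate b , (_ , ⋂-convex (λ i → halfPlane-convex (side i)) , cut)
                           , 2 , s≤s z≤n , s≤s (s≤s z≤n) , side , cut))
      where
      side : Fin 2 → Coefficients
      side zero       = G
      side (suc zero) = H
      cut : ∀ p → p ∈ tabulate b ⇔ (∀ i → HalfPlane (side i) (point p))
      cut p = mk⇔
        (λ p∈ → let (g , h) = Equivalence.to (b⇔ p) (∈-tabulate⁻ p∈)
                in λ { zero → g ; (suc zero) → h })
        (λ gh → ∈-tabulate⁺ (Equivalence.from (b⇔ p) (gh zero , gh (suc zero))))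

foldr₁-⊓-attained : ∀ {a} {A : Set a} {m} (f : A → ℕ) (xs : Vec A (ℕ.suc m)) →
                    ∃[ k ] f (lookup xs k) ≡ foldr₁ ℕ._⊓_ (map f xs)
foldr₁-⊓-attained f (x ∷ []) = zero , refl
foldr₁-⊓-attained f (x ∷ y ∷ xs) with ℕₚ.⊓-sel (f x) (foldr₁ ℕ._⊓_ (map f (y ∷ xs)))
... | inj₁ eq = zero , ≡.sym eq
... | inj₂ eq = let (k , eqₖ) = foldr₁-⊓-attained f (y ∷ xs) in suc k , ≡.trans eqₖ (≡.sym eq)

-- Convex partitions cut out by half-planes

module UpperBound (𝓡 : RealNumbers) {n : ℕ} (S : Plane.ColouredPointSet 𝓡 n) where
  open Plane 𝓡
  open ColouredPointSet S
  open Region 𝓡 S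
  open Hull 𝓡 S using (hull-≤; hull-≰)

  -- The complement of a closed half-plane is open and so is not a `HalfPlane`. It is convex, which
  -- is what an island demands of the set cutting it out.
  Side : Bool → Coefficients → Point → Set
  Side true  h p = HalfPlane h p
  Side false h p = ¬ HalfPlane h p

  side-convex : ∀ s h → IsConvex (Side s h)
  side-convex true  = halfPlane-convex
  side-convex false = ¬halfPlane-convex

  hull-side : ∀ s h {Z p} → (∀ i → i ∈ Z → Side s h (point i)) → ConvexHull S Z p → Side s h p
  hull-side true  h = hull-≤ (Coefficients.a h) (Coefficients.b h) (Coefficients.c h)
  hull-side false h = hull-≰ (Coefficients.a h) (Coefficients.b h) (Coefficients.c h)

  opposite-sides : ∀ {s s′} h {p} → s ≢ s′ → Side s h p → ¬ Side s′ h p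
  opposite-sides {true}  {true}  h s≢s′ = contradiction refl s≢s′
  opposite-sides {false} {false} h s≢s′ = contradiction refl s≢s′
  opposite-sides {true}  {false} h _ p∈ p∉ = p∉ p∈
  opposite-sides {false} {true}  h _ p∉ p∈ = p∉ p∈

  -- The rows of `σ` are the sign vectors of the cells of an arrangement of half-planes. Two
  -- distinct cells lie on opposite sides of one of the `H j`, which makes their hulls disjoint.
  module _ {t m} (H : Fin t → Coefficients) (σ : Fin (ℕ.suc m) → Fin t → Bool)
    (σ-separates : ∀ {k l} → k ≢ l → ∃[ j ] σ k j ≢ σ l j)
    (κ : Fin n → Fin (ℕ.suc m)) (κ-side : ∀ p j → Side (σ (κ p) j) (H j) (point p))
    where

    labelled : Fin (ℕ.suc m) → Fin n → Bool
    labelled k p = does (κ p ≟ k)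

    private
      part : Fin (ℕ.suc m) → Subset n
      part k = tabulate (labelled k)

      ∈-part⁻ : ∀ {k p} → p ∈ part k → κ p ≡ k
      ∈-part⁻ {k} {p} p∈ = does⁻ (κ p ≟ k) (∈-tabulate⁻ {labelled k} p∈)

      ∈-part⁺ : ∀ {k p} → κ p ≡ k → p ∈ part k
      ∈-part⁺ {k} {p} eq = ∈-tabulate⁺ (dec-true (κ p ≟ k) eq)

      part-side : ∀ k j p → p ∈ part k → Side (σ k j) (H j) (point p)
      part-side k j p p∈ = ≡.subst (λ k → Side (σ k j) (H j) (point p)) (∈-part⁻ p∈) (κ-side p j)

      part-island : ∀ k → Island S (part k)
      part-island k = (λ q → ∀ j → Side (σ k j) (H j) q) , ⋂-convex (λ j → side-convex (σ k j) (H j)) , λ p →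
        -- A point on all the sides prescribed by `k` has label `k`, since any other label differs
        -- from `k` in the sign of some `H j`.
        mk⇔ (λ p∈ j → part-side k j p p∈) (λ sides → ∈-part⁺ (decidable-stable (κ p ≟ k) λ κp≢k →
          let (j , σ≢) = σ-separates κp≢k in opposite-sides (H j) σ≢ (κ-side p j) (sides j)))

      parts : Vec (Subset n) (ℕ.suc m)
      parts = tabulate part

      lookup-parts : ∀ k → part k ≡ lookup parts k
      lookup-parts k = ≡.sym (lookup∘tabulate part k)

      ∈-parts⁻ : ∀ {k p} → p ∈ lookup parts k → κ p ≡ k
      ∈-parts⁻ {k} {p} = ∈-part⁻ ∘ ≡.subst (p ∈_) (≡.sym (lookup-parts k))

      partition : (∀ k → Nonempty (part k)) → ConvexPartition S
      partition nonempty = record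
        { parts    = parts
        ; nonempty = λ k → ≡.subst Nonempty (lookup-parts k) (nonempty k)
        ; covering = λ p → κ p , ≡.subst (p ∈_) (lookup-parts (κ p)) (∈-part⁺ refl)
        ; disjoint = λ k≢l (p , p∈) → let (p∈k , p∈l) = x∈p∩q⁻ _ _ p∈
                                      in k≢l (≡.trans (≡.sym (∈-parts⁻ p∈k)) (∈-parts⁻ p∈l))
        ; islands  = λ k → ≡.subst (Island S) (lookup-parts k) (part-island k)
        ; hulls-disjoint = λ {k} {l} k≢l q (q∈k , q∈l) →
            let (j , σ≢) = σ-separates k≢l
                inSide : ∀ k → ConvexHull S (lookup parts k) q → Side (σ k j) (H j) q
                inSide k = hull-side (σ k j) (H j) λ p p∈ →
                  part-side k j p (≡.subst (p ∈_) (≡.sym (lookup-parts k)) p∈)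
            in opposite-sides (H j) σ≢ (inSide k q∈k) (inSide l q∈l)
        }

    -- If every cell contains a point, the cells form a convex partition, whose discrepancy is
    -- attained by one of its parts. Otherwise some cell is empty and has weight 0, which is light
    -- as well.
    light-label : ∀ {c} → (∀ Π → discΠ S Π ℕ.≤ c) → ∃[ k ] ℤ.∣ weight ω (labelled k) ∣ ℕ.≤ c
    light-label {c} maximal with all? (nonempty? ∘ part)
    ... | yes nonempty = let (k , eq) = foldr₁-⊓-attained (disc S) parts in
      k , ≡.subst (ℕ._≤ c) (≡.trans (≡.sym eq)
            (≡.trans (cong (disc S) (≡.sym (lookup-parts k))) (disc-tabulate (labelled k)))) (maximal (partition nonempty))
    ... | no ¬nonempty = let (k , empty) = ¬∀⟶∃¬ _ _ (nonempty? ∘ part) ¬nonempty in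
      k , ≡.subst (ℕ._≤ c) (≡.sym (cong ℤ.∣_∣ (≡.trans
            (weight-cong ω λ p → dec-false (κ p ≟ k) λ eq → empty (p , ∈-part⁺ eq)) (weight-∅ ω)))) z≤n

  imbalance≡ : ℕ.∣ ∣ R ∣ - ∣ B ∣ ∣ ≡ ℤ.∣ weight ω (λ _ → true) ∣
  imbalance≡ = ≡.trans (cong₂ (λ X Y → ℕ.∣ ∣ X ∣ - ∣ Y ∣ ∣) (≡.sym (∩-identityˡ R)) (≡.sym (∩-identityˡ B)))
    (≡.trans (disc≡∣weight∣ ⊤) (cong ℤ.∣_∣ (weight-cong ω λ p → lookup-replicate p true)))

  weight-split : ∀ (b b′ : Fin n → Bool) → weight ω b ≡ weight ω (λ p → b p ∧ b′ p) ℤ.+ weight ω (λ p → b p ∧ not (b′ p))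
  weight-split b b′ = begin
    weight ω b                            ≡⟨ ℤₚ.+-identityʳ _ ⟨
    weight ω b ℤ.+ 0ℤ                     ≡⟨ cong (λ x → weight ω b ℤ.+ x) (weight-∅ ω) ⟨
    weight ω b ℤ.+ weight ω (λ _ → false) ≡⟨ weight-+ ω b (λ _ → false) _ _ (λ p → split (b p) (b′ p)) ⟩
    weight ω (λ p → b p ∧ b′ p) ℤ.+ weight ω (λ p → b p ∧ not (b′ p)) ∎
    where
    open ≡.≡-Reasoning
    split : ∀ x y → χ x ℤ.+ 0ℤ ≡ χ (x ∧ y) ℤ.+ χ (x ∧ not y)
    split false y     = refl
    split true  false = refl
    split true  true  = refl

  module _ {c} (maximal : ∀ Π → discΠ S Π ℕ.≤ c) where

    private
      μ : ℕ
      μ = c ℕ.+ ℤ.∣ weight ω (λ _ → true) ∣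

      c≤μ : c ℕ.≤ μ
      c≤μ = ℕₚ.m≤m+n c _

    imbalance≤ : ℕ.∣ ∣ R ∣ - ∣ B ∣ ∣ ℕ.≤ c
    -- With no half-plane and one cell, the partition consists of `S` alone.
    imbalance≤ with light-label {t = 0} {m = 0} (λ ()) (λ _ ()) (λ { {0F} {0F} 0≢0 → contradiction refl 0≢0 })
                      (λ _ → 0F) (λ _ ()) maximal
    ... | 0F , w≤c = ≡.subst (ℕ._≤ c) (≡.sym imbalance≡) w≤c

    halfPlane-light : ∀ h (h? : ∀ p → Dec (HalfPlane h (point p))) → ℤ.∣ weight ω (does ∘ h?) ∣ ℕ.≤ μ
    halfPlane-light h h? with light-label {t = 1} {m = 1} (λ _ → h) (λ k _ → does (k ≟ 0F))
      (λ { {0F} {0F} k≢l → contradiction refl k≢l ; {0F} {1F} _ → 0F , λ () ; {1F} {0F} _ → 0F , λ ()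
         ; {1F} {1F} k≢l → contradiction refl k≢l })
      (λ p → if does (h? p) then 0F else 1F) side maximal
      where
      side : ∀ p j → Side (does ((if does (h? p) then 0F else 1F) ≟ 0F)) h (point p)
      side p _ with h? p
      ... | yes p∈ = p∈
      ... | no  p∉ = p∉
    ... | 0F , light = ℕₚ.≤-trans (ℕₚ.≤-reflexive (cong ℤ.∣_∣ (weight-cong ω λ p → label (does (h? p)))))
                        (ℕₚ.≤-trans light c≤μ)
      where
      label : ∀ b → b ≡ does ((if b then 0F else 1F) ≟ 0F)
      label true  = refl
      label false = refl
    -- Here the complement is the light cell, and the weight of the half-plane is the total minus
    -- that of the complement.
    ... | 1F , light = begin
      ℤ.∣ weight ω (does ∘ h?) ∣ ≡⟨ cong ℤ.∣_∣ (x≡x+y-y (weight ω (does ∘ h?)) (weight ω (not ∘ does ∘ h?))) ⟩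
      ℤ.∣ weight ω (does ∘ h?) ℤ.+ weight ω (not ∘ does ∘ h?) ℤ.- weight ω (not ∘ does ∘ h?) ∣
        ≡⟨ cong (λ x → ℤ.∣ x ℤ.- weight ω (not ∘ does ∘ h?) ∣) (weight-split (λ _ → true) (does ∘ h?)) ⟨
      ℤ.∣ weight ω (λ _ → true) ℤ.- weight ω (not ∘ does ∘ h?) ∣ ≤⟨ ℤₚ.∣i-j∣≤∣i∣+∣j∣ (weight ω (λ _ → true)) _ ⟩
      ℤ.∣ weight ω (λ _ → true) ∣ ℕ.+ ℤ.∣ weight ω (not ∘ does ∘ h?) ∣
        ≡⟨ cong (λ x → ℤ.∣ weight ω (λ _ → true) ∣ ℕ.+ ℤ.∣ x ∣) (weight-cong ω λ p → label (does (h? p))) ⟩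
      ℤ.∣ weight ω (λ _ → true) ∣ ℕ.+ _ ≤⟨ ℕₚ.+-monoʳ-≤ ℤ.∣ weight ω (λ _ → true) ∣ light ⟩
      ℤ.∣ weight ω (λ _ → true) ∣ ℕ.+ c ≡⟨ ℕₚ.+-comm _ c ⟩
      μ ∎
      where
      open ℕₚ.≤-Reasoning
      x≡x+y-y : ∀ x y → x ≡ x ℤ.+ y ℤ.- y
      x≡x+y-y = ℤ-Solver.solve-∀
      label : ∀ b → not b ≡ does ((if b then 0F else 1F) ≟ 1F)
      label true  = refl
      label false = refl

    -- Some quadrant is light, though perhaps not the wedge itself. In terms of weights, if an
    -- adjacent quadrant is light, the wedge is a half-plane minus that quadrant; if the opposite
    -- one is, the wedge is the sum of both half-planes and the opposite quadrant, minus the total.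
    wedge-light : ∀ g h (g? : ∀ p → Dec (HalfPlane g (point p))) (h? : ∀ p → Dec (HalfPlane h (point p))) →
                  ℤ.∣ weight ω (λ p → does (g? p) ∧ does (h? p)) ∣ ℕ.≤ 4 ℕ.* μ
    wedge-light g h g? h? = conclude (light-label H σ separates κ side maximal)
      where
      open ℕₚ.≤-Reasoning
      H : Fin 2 → Coefficients
      H 0F = g
      H 1F = h
      quadrant : Bool → Bool → Fin 4
      quadrant true  true  = 0F
      quadrant true  false = 1F
      quadrant false true  = 2F
      quadrant false false = 3F
      σ : Fin 4 → Fin 2 → Bool
      σ 0F _  = true
      σ 1F 0F = true
      σ 1F 1F = false
      σ 2F 0F = false
      σ 2F 1F = true
      σ 3F _  = false
      separates : ∀ {k l} → k ≢ l → ∃[ j ] σ k j ≢ σ l j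
      separates {0F} {0F} k≢l = contradiction refl k≢l
      separates {0F} {1F} _ = 1F , λ ()
      separates {0F} {2F} _ = 0F , λ ()
      separates {0F} {3F} _ = 0F , λ ()
      separates {1F} {0F} _ = 1F , λ ()
      separates {1F} {1F} k≢l = contradiction refl k≢l
      separates {1F} {2F} _ = 0F , λ ()
      separates {1F} {3F} _ = 0F , λ ()
      separates {2F} {0F} _ = 0F , λ ()
      separates {2F} {1F} _ = 0F , λ ()
      separates {2F} {2F} k≢l = contradiction refl k≢l
      separates {2F} {3F} _ = 1F , λ ()
      separates {3F} {0F} _ = 0F , λ ()
      separates {3F} {1F} _ = 0F , λ ()
      separates {3F} {2F} _ = 1F , λ ()
      separates {3F} {3F} k≢l = contradiction refl k≢l
      κ : Fin n → Fin 4
      κ p = quadrant (does (g? p)) (does (h? p))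
      side : ∀ p j → Side (σ (κ p) j) (H j) (point p)
      side p j with g? p | h? p
      side p 0F | yes p∈ | yes _ = p∈
      side p 0F | yes p∈ | no _  = p∈
      side p 0F | no p∉  | yes _ = p∉
      side p 0F | no p∉  | no _  = p∉
      side p 1F | yes _  | yes p∈ = p∈
      side p 1F | no _   | yes p∈ = p∈
      side p 1F | yes _  | no p∉  = p∉
      side p 1F | no _   | no p∉  = p∉

      w : (Bool → Bool → Bool) → ℤ
      w f = weight ω λ p → f (does (g? p)) (does (h? p))
      label : Fin 4 → Bool → Bool → Bool
      label k x y = does (quadrant x y ≟ k)
      w-cong : ∀ f f′ → f true true ≡ f′ true true → f true false ≡ f′ true false →
               f false true ≡ f′ false true → f false false ≡ f′ false false → w f ≡ w f′
      w-cong f f′ tt tf ft ff = weight-cong ω λ p → table (does (g? p)) (does (h? p))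
        where
        table : ∀ x y → f x y ≡ f′ x y
        table true  true  = tt
        table true  false = tf
        table false true  = ft
        table false false = ff
      -- `x₀` belongs to the wedge and `x₃` to the opposite quadrant; `x₀ + x₁` is the weight of `g`
      -- and `x₀ + x₂` that of `h`.
      x₀ x₁ x₂ x₃ total : ℤ
      x₀ = w _∧_
      x₁ = w λ x y → x ∧ not y
      x₂ = w λ x y → not x ∧ y
      x₃ = w λ x y → not x ∧ not y
      total = weight ω λ _ → true
      ∣row∣ : ℤ.∣ x₀ ℤ.+ x₁ ∣ ℕ.≤ μ
      ∣row∣ = ≡.subst (λ x → ℤ.∣ x ∣ ℕ.≤ μ) (weight-split (does ∘ g?) (does ∘ h?)) (halfPlane-light g g?)
      ∣column∣ : ℤ.∣ x₀ ℤ.+ x₂ ∣ ℕ.≤ μ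
      ∣column∣ = ≡.subst (λ x → ℤ.∣ x ∣ ℕ.≤ μ)
        (≡.trans (weight-split (does ∘ h?) (does ∘ g?)) (cong₂ ℤ._+_
          (w-cong (λ x y → y ∧ x) _∧_ refl refl refl refl)
          (w-cong (λ x y → y ∧ not x) (λ x y → not x ∧ y) refl refl refl refl)))
        (halfPlane-light h h?)
      total≡ : total ≡ (x₀ ℤ.+ x₁) ℤ.+ (x₂ ℤ.+ x₃)
      total≡ = ≡.trans (weight-split (λ _ → true) (does ∘ g?))
        (cong₂ ℤ._+_ (weight-split (does ∘ g?) (does ∘ h?)) (weight-split (not ∘ does ∘ g?) (does ∘ h?)))
      by-x₁ : ∀ x y → x ≡ x ℤ.+ y ℤ.- y
      by-x₁ = ℤ-Solver.solve-∀
      by-x₃ : ∀ a b c e → a ≡ (a ℤ.+ b) ℤ.+ (a ℤ.+ c) ℤ.+ (e ℤ.- ((a ℤ.+ b) ℤ.+ (c ℤ.+ e)))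
      by-x₃ = ℤ-Solver.solve-∀
      4μ : ∀ μ → μ ℕ.+ μ ℕ.+ (μ ℕ.+ μ) ≡ 4 ℕ.* μ
      4μ = ℕ-Solver.solve-∀
      via : ∀ y → ℤ.∣ x₀ ℤ.+ y ∣ ℕ.≤ μ → ℤ.∣ y ∣ ℕ.≤ c → ℤ.∣ x₀ ∣ ℕ.≤ 4 ℕ.* μ
      via y ∣x₀+y∣ ∣y∣ = begin
        ℤ.∣ x₀ ∣                     ≡⟨ cong ℤ.∣_∣ (by-x₁ x₀ y) ⟩
        ℤ.∣ x₀ ℤ.+ y ℤ.- y ∣         ≤⟨ ℤₚ.∣i-j∣≤∣i∣+∣j∣ (x₀ ℤ.+ y) y ⟩
        ℤ.∣ x₀ ℤ.+ y ∣ ℕ.+ ℤ.∣ y ∣   ≤⟨ ℕₚ.+-mono-≤ ∣x₀+y∣ (ℕₚ.≤-trans ∣y∣ c≤μ) ⟩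
        μ ℕ.+ μ                      ≤⟨ ℕₚ.m≤m+n _ _ ⟩
        μ ℕ.+ μ ℕ.+ (μ ℕ.+ μ)        ≡⟨ 4μ μ ⟩
        4 ℕ.* μ                      ∎
      conclude : ∃[ k ] ℤ.∣ w (label k) ∣ ℕ.≤ c → ℤ.∣ x₀ ∣ ℕ.≤ 4 ℕ.* μ
      conclude (0F , light) = begin
        ℤ.∣ x₀ ∣           ≡⟨ cong ℤ.∣_∣ (w-cong _∧_ (label 0F) refl refl refl refl) ⟩
        ℤ.∣ w (label 0F) ∣ ≤⟨ ℕₚ.≤-trans light c≤μ ⟩
        μ                  ≤⟨ ℕₚ.m≤m+n μ _ ⟩
        4 ℕ.* μ            ∎
      conclude (1F , light) = via x₁ ∣row∣ (≡.subst (λ x → ℤ.∣ x ∣ ℕ.≤ c) (w-cong (label 1F) (λ x y → x ∧ not y) refl refl refl refl) light)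
      conclude (2F , light) = via x₂ ∣column∣ (≡.subst (λ x → ℤ.∣ x ∣ ℕ.≤ c) (w-cong (label 2F) (λ x y → not x ∧ y) refl refl refl refl) light)
      conclude (3F , light) = begin
        ℤ.∣ x₀ ∣ ≡⟨ cong ℤ.∣_∣ (≡.trans (by-x₃ x₀ x₁ x₂ x₃)
                      (cong (λ t → (x₀ ℤ.+ x₁) ℤ.+ (x₀ ℤ.+ x₂) ℤ.+ (x₃ ℤ.- t)) (≡.sym total≡))) ⟩
        ℤ.∣ (x₀ ℤ.+ x₁) ℤ.+ (x₀ ℤ.+ x₂) ℤ.+ (x₃ ℤ.- total) ∣
          ≤⟨ ℤₚ.∣i+j∣≤∣i∣+∣j∣ ((x₀ ℤ.+ x₁) ℤ.+ (x₀ ℤ.+ x₂)) (x₃ ℤ.- total) ⟩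
        ℤ.∣ (x₀ ℤ.+ x₁) ℤ.+ (x₀ ℤ.+ x₂) ∣ ℕ.+ ℤ.∣ x₃ ℤ.- total ∣
          ≤⟨ ℕₚ.+-mono-≤
               (ℕₚ.≤-trans (ℤₚ.∣i+j∣≤∣i∣+∣j∣ (x₀ ℤ.+ x₁) (x₀ ℤ.+ x₂)) (ℕₚ.+-mono-≤ ∣row∣ ∣column∣))
               (ℕₚ.≤-trans (ℤₚ.∣i-j∣≤∣i∣+∣j∣ x₃ total) (ℕₚ.+-mono-≤
                 (ℕₚ.≤-trans (≡.subst (λ x → ℤ.∣ x ∣ ℕ.≤ c) (w-cong (label 3F) (λ x y → not x ∧ not y) refl refl refl refl) light) c≤μ)
                 (ℕₚ.m≤n+m _ c))) ⟩
        μ ℕ.+ μ ℕ.+ (μ ℕ.+ μ) ≡⟨ 4μ μ ⟩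
        4 ℕ.* μ ∎

    separable-light : ∀ (I : SeparableIsland S 2) → disc S (proj₁ I) ℕ.≤ 4 ℕ.* (c ℕ.+ ℕ.∣ ∣ R ∣ - ∣ B ∣ ∣)
    separable-light (I , _ , t , 1≤t , t≤2 , H , cut) rewrite imbalance≡ | disc≡∣weight∣ I =
      decidable-stable (_ ℕₚ.≤? _) (
        ¬¬-∀ (λ p → ¬¬-∀ λ j → ¬¬-excluded-middle {A = HalfPlane (H j) (point p)}) >>= λ H? →
        return (two-halfPlanes t 1≤t t≤2 H H? cut))
      where
      membership : ∀ p (b : Bool) → (p ∈ I → b ≡ true) → (b ≡ true → p ∈ I) → lookup I p ≡ b
      membership p true  _  from = []=⇒lookup (from refl)
      membership p false to _ with lookup I p in eq
      ... | true  = ≡.sym (to (lookup⇒[]= p I eq))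
      ... | false = refl
      two-halfPlanes : ∀ t → 1 ℕ.≤ t → t ℕ.≤ 2 → (H : Fin t → Coefficients) →
        (∀ p j → Dec (HalfPlane (H j) (point p))) → (_CutOutBy_ S I (λ q → ∀ j → HalfPlane (H j) q)) →
        ℤ.∣ weight ω (lookup I) ∣ ℕ.≤ 4 ℕ.* μ
      two-halfPlanes t@(ℕ.suc t′) _ t≤2 H H? cut = ≡.subst (λ x → ℤ.∣ x ∣ ℕ.≤ 4 ℕ.* μ)
        (≡.sym (weight-cong ω λ p → membership p _
          (λ p∈ → let h = Equivalence.to (cut p) p∈ in cong₂ _∧_ (dec-true (H? p 0F) (h 0F)) (dec-true (H? p last) (h last)))
          (λ b → Equivalence.from (cut p) (all-sides p b))))
        (wedge-light (H 0F) (H last) (λ p → H? p 0F) (λ p → H? p last))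
        where
        last : Fin t
        -- For `t` equal to 1 the last half-plane is the first one, so intersecting these two covers
        -- both values of `t`.
        last = fromℕ t′
        ends-only : ∀ {t′} → ℕ.suc t′ ℕ.≤ 2 → (j : Fin (ℕ.suc t′)) → j ≡ 0F ⊎ j ≡ fromℕ t′
        ends-only {0} _ 0F = inj₁ refl
        ends-only {1} _ 0F = inj₁ refl
        ends-only {1} _ 1F = inj₂ refl
        ends-only {ℕ.suc (ℕ.suc _)} (s≤s (s≤s ())) _
        ∧-both : ∀ x {y} → x ∧ y ≡ true → x ≡ true × y ≡ true
        ∧-both true eq = refl , eq
        all-sides : ∀ p → does (H? p 0F) ∧ does (H? p last) ≡ true → ∀ j → HalfPlane (H j) (point p)
        all-sides p b j = let (b₀ , b₁) = ∧-both (does (H? p 0F)) b in case ends-only t≤2 j of λ where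
          (inj₁ refl) → does⁻ (H? p 0F) b₀
          (inj₂ refl) → does⁻ (H? p last) b₁

foldr₁-⊓-≤ : ∀ {a} {A : Set a} {m} (f : A → ℕ) (xs : Vec A (ℕ.suc m)) k →
             foldr₁ ℕ._⊓_ (map f xs) ℕ.≤ f (lookup xs k)
foldr₁-⊓-≤ f (x ∷ [])     zero    = ℕₚ.≤-refl
foldr₁-⊓-≤ f (x ∷ y ∷ xs) zero    = ℕₚ.m⊓n≤m _ _
foldr₁-⊓-≤ f (x ∷ y ∷ xs) (suc k) = ℕₚ.≤-trans (ℕₚ.m⊓n≤n (f x) _) (foldr₁-⊓-≤ f (y ∷ xs) k)

-- Sweeping a convex partition

module LowerBound (𝓡 : RealNumbers) {n : ℕ} (S : Plane.ColouredPointSet 𝓡 n) (Π : Plane.ConvexPartition 𝓡 S)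
  {D : ℕ} (maximal : ∀ (I : Plane.SeparableIsland 𝓡 S 2) → Plane.disc 𝓡 S (proj₁ I) ℕ.≤ D)
  where
  open RealNumbers 𝓡
  open HeytingField heytingField using (_-_; -_)
  open CommutativeRing commutativeRing using () renaming (refl to ≈-refl; sym to ≈-sym)
  open IsStrictPartialOrder isStrictPartialOrder
    using () renaming (irrefl to <-irrefl; trans to <-trans)
  open OrderedField 𝓡
  open Solver using (solve; _:=_; _:+_; _:*_; _:-_; :-_; con)
  open Plane 𝓡
  open ColouredPointSet S
  open ConvexPartition Π
  open Region 𝓡 S
  open Hull 𝓡 S

  private
    M : ℕ
    M = ℕ.suc m

    X Y : Fin n → ℝ
    X = proj₁ ∘ point
    Y = proj₂ ∘ point

    Z : Fin M → Subset n
    Z = lookup parts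

  κ : Fin n → Fin M
  κ p = proj₁ (covering p)

  κ-∈ : ∀ p → p ∈ Z (κ p)
  κ-∈ p = proj₂ (covering p)

  κ-unique : ∀ {p K} → p ∈ Z K → κ p ≡ K
  κ-unique {p} {K} p∈ = decidable-stable (κ p ≟ K) λ κp≢K → disjoint κp≢K (p , x∈p∩q⁺ (κ-∈ p , p∈))

  -- Only finitely many comparisons enter the sweep, so they are taken as decided here; `discΠ≤14D`
  -- supplies them under a double negation.
  module Sweeping
    (X<? : ∀ p q → Dec (X p < X q))
    (Below? : ∀ K L → Dec (Z K Below Z L))
    where

    left-of : Fin n → Subset n
    left-of p = tabulate λ q → does (X<? q p)

    ∈-left-of⁻ : ∀ {p q} → q ∈ left-of p → X q < X p
    ∈-left-of⁻ {p} {q} q∈ = does⁻ (X<? q p) (∈-tabulate⁻ {λ q → does (X<? q p)} q∈)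

    ∈-left-of⁺ : ∀ {p q} → X q < X p → q ∈ left-of p
    ∈-left-of⁺ {p} {q} lt = ∈-tabulate⁺ (dec-true (X<? q p) lt)

    -- Columns are numbered by rank; some columns may contain no point.
    ρ : Fin n → ℕ
    ρ p = ∣ left-of p ∣

    ρ-mono-< : ∀ {p q} → X p < X q → ρ p ℕ.< ρ q
    ρ-mono-< lt = p⊂q⇒∣p∣<∣q∣
      ((λ s∈ → ∈-left-of⁺ (<-trans (∈-left-of⁻ s∈) lt)) , _ , ∈-left-of⁺ lt , <-irrefl ≈-refl ∘ ∈-left-of⁻)

    ρ-cancel-≤ : ∀ {p q} → ρ p ℕ.≤ ρ q → X p ≤ X q
    ρ-cancel-≤ ρ≤ lt = ℕₚ.<⇒≱ (ρ-mono-< lt) ρ≤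

    ρ-cancel-< : ∀ {p q} → ρ p ℕ.< ρ q → X p < X q
    ρ-cancel-< {p} {q} ρ< with X<? p q
    ... | yes lt = lt
    -- If `X q ≤ X p`, every point left of `q` is also left of `p`, whence `ρ q ≤ ρ p`.
    ... | no ¬lt = contradiction (p⊆q⇒∣p∣≤∣q∣ {p = left-of q} {left-of p} λ {s} s∈ →
        ∈-left-of⁺ (decidable-stable (X<? s p) (<-≤-trans (∈-left-of⁻ s∈) ¬lt))) (ℕₚ.<⇒≱ ρ<)

    Extreme : (ℕ → ℕ → Set) → Fin M → Set
    Extreme _⊑_ K = ∃[ p ] p ∈ Z K × (∀ q → q ∈ Z K → ρ p ⊑ ρ q)

    leftmost : ∀ K → Extreme ℕ._≤_ K
    leftmost K with least {P = _∈ Z K} {λ p q → ρ p ℕ.≤ ρ q} (_∈? Z K) (λ _ _ → ℕₚ.≤-total _ _) (λ _ _ _ → ℕₚ.≤-trans)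
    ... | inj₁ extreme = extreme
    ... | inj₂ none    = let (p , p∈) = nonempty K in contradiction p∈ (none p)

    rightmost : ∀ K → Extreme ℕ._≥_ K
    rightmost K with least {P = _∈ Z K} {λ p q → ρ p ℕ.≥ ρ q} (_∈? Z K) (λ {p} {q} _ _ → ℕₚ.≤-total (ρ q) (ρ p)) (λ _ _ _ → flip ℕₚ.≤-trans)
    ... | inj₁ extreme = extreme
    ... | inj₂ none    = let (p , p∈) = nonempty K in contradiction p∈ (none p)

    l r : Fin M → ℕ
    l K = ρ (proj₁ (leftmost K))
    r K = ρ (proj₁ (rightmost K))

    l≤r : ∀ K → l K ℕ.≤ r K
    l≤r K = proj₂ (proj₂ (leftmost K)) _ (proj₁ (proj₂ (rightmost K)))

    Active : ℕ → Fin M → Set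
    Active = Occupies l r

    ∈⇒active : ∀ {p K} → p ∈ Z K → Active (ρ p) K
    ∈⇒active {p} {K} p∈ = proj₂ (proj₂ (leftmost K)) p p∈ , proj₂ (proj₂ (rightmost K)) p p∈

    κ-active : ∀ p → Active (ρ p) (κ p)
    κ-active p = ∈⇒active (κ-∈ p)

    last-column : ∀ j → (∃[ s ] ρ s ℕ.≤ j × (∀ p → ρ p ℕ.≤ j → ρ p ℕ.≤ ρ s)) ⊎ (∀ p → ¬ (ρ p ℕ.≤ j))
    last-column j = least {P = λ p → ρ p ℕ.≤ j} {λ p q → ρ q ℕ.≤ ρ p} (λ p → ρ p ℕₚ.≤? j)
      (λ {p} {q} _ _ → ℕₚ.≤-total (ρ q) (ρ p)) (λ _ _ _ → flip ℕₚ.≤-trans)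

    -- All the parts that are active in a column meet a common vertical line.
    column-line : ∀ {j K} → Active j K →
                  ∃[ x ] (∀ L → Active j L → DoubleNegation (∃[ y ] Hull (Z L) (x , y)))
    column-line {j} {K} (lK≤j , _) with last-column j
    ... | inj₂ none = contradiction lK≤j (none _)
    -- The line passes through the last occupied column up to `j`, because column `j` may contain no
    -- point. Each active part starts at or before it and ends at or after it.
    ... | inj₁ (s , ρs≤j , last) = X s , λ L (lL≤j , j≤rL) →
      hull-meets-vertical (proj₁ (proj₂ (leftmost L))) (proj₁ (proj₂ (rightmost L)))
        (ρ-cancel-≤ (last _ lL≤j)) (ρ-cancel-≤ (ℕₚ.≤-trans ρs≤j j≤rL))

    point-line : ∀ {p K} → Active (ρ p) K → DoubleNegation (∃[ y ] Hull (Z K) (X p , y))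
    point-line {p} {K} (lK≤ρ , ρ≤rK) = hull-meets-vertical
      (proj₁ (proj₂ (leftmost K))) (proj₁ (proj₂ (rightmost K))) (ρ-cancel-≤ lK≤ρ) (ρ-cancel-≤ ρ≤rK)

    -- The vertical order of the parts.

    _≺_ : Fin M → Fin M → Set
    K ≺ L = Z K Below Z L

    ordered : ∀ {K L x y y′} → K ≺ L → Hull (Z K) (x , y) → Hull (Z L) (x , y′) → ¬ (y′ ≤ y)
    ordered K≺L h h′ y′≤y = below⇒¬overhangs K≺L (_ , _ , h , h′ , ≈-refl , y′≤y)

    -- Parts whose horizontal ranges are disjoint lie below each other in both directions, by steep
    -- lines. A common column supplies a vertical line through both hulls, and the heights on it
    -- decide.
    ≺-asym : ∀ {j K L} → Active j K → Active j L → K ≺ L → ¬ (L ≺ K)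
    ≺-asym {K = K} {L} aK aL K≺L L≺K = let (_ , meets) = column-line aK in
      meets K aK λ (y , h) → meets L aL λ (y′ , h′) →
      ordered K≺L h h′ λ y<y′ → ordered L≺K h′ h (<⇒≤ y<y′)

    ≺-connected : ∀ {K L} → K ≢ L → K ≺ L ⊎ L ≺ K
    ≺-connected {K} {L} K≢L with Below? K L | Below? L K
    ... | yes K≺L | _       = inj₁ K≺L
    ... | no _    | yes L≺K = inj₂ L≺K
    ... | no K⊀L  | no L⊀K  = ⊥-elim (separation (nonempty K) (nonempty L) (hulls-disjoint K≢L) [ K⊀L , L⊀K ]′)

    -- A reversed comparison of `K` and `N` would give a cyclic order of heights on a vertical line
    -- that meets all three hulls.
    ≺-trans : ∀ {j K L N} → Active j K → Active j L → Active j N → K ≺ L → L ≺ N → K ≺ N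
    ≺-trans {K = K} {L} {N} aK aL aN K≺L L≺N with K ≟ N
    ... | yes refl = contradiction L≺N (≺-asym aK aL K≺L)
    ... | no  K≢N  = [ id , (λ N≺K → let (_ , meets) = column-line aK in ⊥-elim (
      meets K aK λ (y , h) → meets L aL λ (y′ , h′) → meets N aN λ (y″ , h″) →
      ordered K≺L h h′ λ y<y′ → ordered L≺N h′ h″ λ y′<y″ → ordered N≺K h″ h (<⇒≤ (<-trans y<y′ y′<y″)))) ]′
      (≺-connected K≢N)

    open SweepLine ω ρ l r l≤r _≺_ Below? ≺-asym ≺-trans (λ _ _ → ≺-connected)
      using (below; within) public

    vertical : ∀ s → Coefficients
    vertical s = record { a = one ; b = 0# ; c = X s ; nondegenerate = inj₁ (Equivalence.from #⇔<⊎> (inj₂ 0<one)) }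

    vertical-⇔ : ∀ s p → HalfPlane (vertical s) (point p) ⇔ X p ≤ X s
    vertical-⇔ s p = mk⇔ (≤-resp-≈ eq ≈-refl) (≤-resp-≈ (≈-sym eq) ≈-refl)
      where
      eq : one * X p + 0# * Y p ≈ X p
      eq = solve 2 (λ x y → con 1ℤ :* x :+ con 0ℤ :* y := x) ≈-refl (X p) (Y p)

    -- The boundary is the vertical line through the last occupied column before `j`; the
    -- alternative is that no point precedes column `j`.
    below-halfPlane : ∀ j → (∃[ G ] ∀ p → ρ p ℕ.< j ⇔ HalfPlane G (point p)) ⊎ (∀ p → ¬ (ρ p ℕ.< j))
    below-halfPlane ℕ.zero = inj₂ λ p ()
    below-halfPlane (ℕ.suc j) with last-column j
    ... | inj₂ none = inj₂ λ p → none p ∘ ℕₚ.≤-pred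
    ... | inj₁ (s , ρs≤j , last) = inj₁ (vertical s , λ p → mk⇔
      (λ ρp<1+j → Equivalence.from (vertical-⇔ s p) (ρ-cancel-≤ (last p (ℕₚ.≤-pred ρp<1+j))))
      (λ p∈ → s≤s (ℕₚ.≮⇒≥ λ j<ρp → Equivalence.to (vertical-⇔ s p) p∈ (ρ-cancel-< (ℕₚ.≤-<-trans ρs≤j j<ρp)))))

    does⇔ : ∀ {A : Set} (A? : Dec A) → does A? ≡ true ⇔ A
    does⇔ A? = mk⇔ (does⁻ A?) (dec-true A?)

    ∧⇔ : ∀ {A B : Set} {x y} → x ≡ true ⇔ A → y ≡ true ⇔ B → x ∧ y ≡ true ⇔ (A × B)
    ∧⇔ {x = true}  x⇔ y⇔ = mk⇔ (λ eq → Equivalence.to x⇔ refl , Equivalence.to y⇔ eq) (Equivalence.from y⇔ ∘ proj₂)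
    ∧⇔ {x = false} x⇔ y⇔ = mk⇔ (λ ()) (Equivalence.from x⇔ ∘ proj₁)

    light-∅ : ∀ b → (∀ p → b p ≡ false) → ℤ.∣ weight ω b ∣ ℕ.≤ D
    light-∅ b b≡false = ≡.subst (ℕ._≤ D) (≡.sym (cong ℤ.∣_∣ (≡.trans (weight-cong ω b≡false) (weight-∅ ω)))) z≤n

    below-bound : ∀ j → ℤ.∣ weight ω (below j) ∣ ℕ.≤ D
    below-bound j with below-halfPlane j
    ... | inj₂ none     = light-∅ (below j) λ p → dec-false (ρ p ℕₚ.<? j) (none p)
    ... | inj₁ (G , G⇔) = wedge-bound maximal (below j) G G λ p → mk⇔
      (λ t → let g = Equivalence.to (G⇔ p) (Equivalence.to (does⇔ (ρ p ℕₚ.<? j)) t) in g , g)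
      (λ (g , _) → Equivalence.from (does⇔ (ρ p ℕₚ.<? j)) (Equivalence.from (G⇔ p) g))

    below∧-bound : ∀ j H (H? : ∀ p → Dec (HalfPlane H (point p))) →
                   ℤ.∣ weight ω (λ p → below j p ∧ does (H? p)) ∣ ℕ.≤ D
    below∧-bound j H H? with below-halfPlane j
    ... | inj₂ none     = light-∅ _ λ p → cong (_∧ does (H? p)) (dec-false (ρ p ℕₚ.<? j) (none p))
    ... | inj₁ (G , G⇔) = wedge-bound maximal _ G H λ p → ∧⇔
      (mk⇔ (Equivalence.to (G⇔ p) ∘ Equivalence.to (does⇔ (ρ p ℕₚ.<? j)))
           (Equivalence.from (does⇔ (ρ p ℕₚ.<? j)) ∘ Equivalence.from (G⇔ p)))
      (does⇔ (H? p))

    -- The sweep is used once for the parts below a given part and, with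
    -- _⊏_ the reverse of _≺_, once for the parts above it.
    module OneSide
      (_⊏_ : Fin M → Fin M → Set) (_⊏?_ : ∀ K L → Dec (K ⊏ L))
      (⊏-asym : ∀ {j K L} → Active j K → Active j L → K ⊏ L → ¬ (L ⊏ K))
      (⊏-trans : ∀ {j K L N} → Active j K → Active j L → Active j N → K ⊏ L → L ⊏ N → K ⊏ N)
      (⊏-connected : ∀ {K L} → K ≢ L → K ⊏ L ⊎ L ⊏ K)
      (cut : ∀ {K U} → K ⊏ U → Coefficients)
      (cut-in  : ∀ {K U} (s : K ⊏ U) {p} → Active (ρ p) K → κ p ≡ K ⊎ κ p ⊏ K → HalfPlane (cut s) (point p))
      (cut-out : ∀ {K U} (s : K ⊏ U) {p} → Active (ρ p) U → U ≡ κ p ⊎ U ⊏ κ p → ¬ HalfPlane (cut s) (point p))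
      where

      private
        module W = SweepLine ω ρ l r l≤r _⊏_ _⊏?_ ⊏-asym ⊏-trans (λ _ _ → ⊏-connected)

      low : Fin M → Fin n → Bool
      low K p = does (κ p ≟ K) ∨ does (κ p ⊏? K)


      chosen : ∀ {K U} → Dec (K ⊏ U) → Coefficients → Coefficients
      chosen (yes s) _ = cut s
      chosen (no _)  h = h

      -- When K ⊏ U fails the cut is irrelevant, and any half-plane will do.
      boundary : Fin M → Fin M → Coefficients
      boundary K U = chosen (K ⊏? U) (vertical (proj₁ (leftmost K)))

      module _ (boundary? : ∀ K U p → Dec (HalfPlane (boundary K U) (point p))) where

        side : Fin M → Maybe (Fin M) → Fin n → Bool
        -- With no part beyond `K`, all points of the column belong to `K` or to parts before it, so
        -- the whole plane serves as the side.
        side K nothing  p = true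
        side K (just U) p = does (boundary? K U p)

        low-true : ∀ {K p} → κ p ≡ K ⊎ κ p ⊏ K → low K p ≡ true
        low-true {K} {p} (inj₁ eq) = cong (_∨ does (κ p ⊏? K)) (dec-true (κ p ≟ K) eq)
        low-true {K} {p} (inj₂ lt) with does (κ p ≟ K)
        ... | true  = refl
        ... | false = dec-true (κ p ⊏? K) lt

        low-false : ∀ {K p} → κ p ≢ K → ¬ (κ p ⊏ K) → low K p ≡ false
        low-false {K} {p} ≢K ⊀K = cong₂ _∨_ (dec-false (κ p ≟ K) ≢K) (dec-false (κ p ⊏? K) ⊀K)

        position : ∀ K p → (κ p ≡ K ⊎ κ p ⊏ K) ⊎ (κ p ≢ K × ¬ (κ p ⊏ K) × K ⊏ κ p)
        position K p with κ p ≟ K | κ p ⊏? K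
        ... | yes eq | _      = inj₁ (inj₁ eq)
        ... | no _   | yes lt = inj₁ (inj₂ lt)
        ... | no ≢K  | no ⊀K  = inj₂ (≢K , ⊀K , [ (λ lt → contradiction lt ⊀K) , id ]′ (⊏-connected ≢K))

        boundary-in : ∀ {K U p} → K ⊏ U → Active (ρ p) K → κ p ≡ K ⊎ κ p ⊏ K → HalfPlane (boundary K U) (point p)
        boundary-in {K} {U} K⊏U aK pos with K ⊏? U
        ... | yes s  = cut-in s aK pos
        ... | no ¬lt = contradiction K⊏U ¬lt

        boundary-out : ∀ {K U p} → K ⊏ U → Active (ρ p) U → U ≡ κ p ⊎ U ⊏ κ p → ¬ HalfPlane (boundary K U) (point p)
        boundary-out {K} {U} K⊏U aU pos with K ⊏? U
        ... | yes s  = cut-out s aU pos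
        ... | no ¬lt = contradiction K⊏U ¬lt

        -- In a column where `U` is the immediate neighbour of `K`, the part of `p` is either `K` or
        -- before `K`, hence inside the cut, or beyond `K`, hence at or beyond `U` and outside the
        -- cut.
        side≡low : ∀ p K N → Active (ρ p) K → W.IsNext (ρ p) K N → side K N p ≡ low K p
        side≡low p K nothing aK none with position K p
        ... | inj₁ pos             = ≡.sym (low-true pos)
        ... | inj₂ (_ , _ , K⊏κp)  = contradiction K⊏κp (none (κ p) (κ-active p))
        side≡low p K (just U) aK (aU , K⊏U , min) with position K p
        ... | inj₁ pos              = ≡.trans (dec-true (boundary? K U p) (boundary-in K⊏U aK pos)) (≡.sym (low-true pos))
        ... | inj₂ (≢K , ⊀K , K⊏κp) = ≡.trans
          (dec-false (boundary? K U p) (boundary-out K⊏U aU (min (κ p) (κ-active p) K⊏κp)))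
          (≡.sym (low-false ≢K ⊀K))

        bound : ∀ K N j → ℤ.∣ weight ω (λ p → below j p ∧ side K N p) ∣ ℕ.≤ D
        bound K nothing  j = ≡.subst (λ x → ℤ.∣ x ∣ ℕ.≤ D) (weight-cong ω λ p → ≡.sym (∧-identityʳ (below j p))) (below-bound j)
        bound K (just U) j = below∧-bound j (boundary K U) (boundary? K U)

        half-bound : sumℕ (λ K → ℤ.∣ weight ω (λ p → within K (ℕ.suc (r K)) p ∧ low K p) ∣) ℕ.≤ 6 ℕ.* D ℕ.* M
        half-bound = W.sum-∣T∣≤ low side side≡low D bound

      half : DoubleNegation (sumℕ (λ K → ℤ.∣ weight ω (λ p → within K (ℕ.suc (r K)) p ∧ low K p) ∣) ℕ.≤ 6 ℕ.* D ℕ.* M)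
      half = ¬¬-∀ (λ K → ¬¬-∀ λ U → ¬¬-∀ λ p → ¬¬-excluded-middle) >>= λ boundary? →
        return (half-bound boundary?)

    upper-cut lower-cut : ∀ {K U} → K ≺ U → Coefficients
    upper-cut s = record { a = - α ; b = one ; c = β ; nondegenerate = inj₂ (Equivalence.from #⇔<⊎> (inj₂ 0<one)) }
      where open _Below_ s
    lower-cut s = record { a = α ; b = - one ; c = - β ; nondegenerate = inj₂ (Equivalence.from #⇔<⊎> (inj₁ -one<0)) }
      where
      open _Below_ s
      -one<0 : - one < 0#
      -one<0 = by-< one (solve 0 (con 0ℤ :- (:- con 1ℤ) := con 1ℤ) ≈-refl) 0<one

    lower-cut-⇔ : ∀ {K U} (s : K ≺ U) → let open _Below_ s in ∀ p → HalfPlane (lower-cut s) p ⇔ β ≤ height α p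
    lower-cut-⇔ s (x , y) = mk⇔ (by-≤ _ eq ∘ ≤⇒0≤) (by-≤ _ (≈-sym eq) ∘ ≤⇒0≤)
      where
      open _Below_ s
      eq : height α (x , y) - β ≈ - β - (α * x + - one * y)
      eq = solve 4 (λ α β x y → (:- α) :* x :+ con 1ℤ :* y :- β := (:- β) :- (α :* x :+ (:- con 1ℤ) :* y)) ≈-refl α β x y

    -- For `p` in a part below `K`: if `p` were above the separating line, the hull point of `K`
    -- vertically above `p` would be above it too.
    upper-cut-in : ∀ {K U} (s : K ≺ U) {p} → Active (ρ p) K → κ p ≡ K ⊎ κ p ≺ K → HalfPlane (upper-cut s) (point p)
    upper-cut-in s {p} aK (inj₁ refl) = <⇒≤ (_Below_.below s p (κ-∈ p))
    upper-cut-in s {p} aK (inj₂ κp≺K) β<h = point-line {p} aK λ (y , h) →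
      ordered κp≺K (hull-point (κ-∈ p)) h λ Yp<y → hull-below s h
        (≤-trans (<⇒≤ β<h) (height-mono (_Below_.α s) ≈-refl (<⇒≤ Yp<y)))

    -- For `p` in a part above `U`: the hull point of `U` vertically below `p` is above the line,
    -- hence so is `p`.
    upper-cut-out : ∀ {K U} (s : K ≺ U) {p} → Active (ρ p) U → U ≡ κ p ⊎ U ≺ κ p → ¬ HalfPlane (upper-cut s) (point p)
    upper-cut-out s {p} aU (inj₁ refl) h≤β = h≤β (_Below_.above s p (κ-∈ p))
    upper-cut-out s {p} aU (inj₂ U≺κp) h≤β = point-line {p} aU λ (y , h) →
      ordered U≺κp h (hull-point (κ-∈ p)) λ y<Yp → hull-above s h
        (≤-trans (height-mono (_Below_.α s) ≈-refl (<⇒≤ y<Yp)) h≤β)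

    lower-cut-in : ∀ {K U} (s : U ≺ K) {p} → Active (ρ p) K → κ p ≡ K ⊎ K ≺ κ p → HalfPlane (lower-cut s) (point p)
    lower-cut-in s {p} aK (inj₁ refl) = Equivalence.from (lower-cut-⇔ s (point p)) (<⇒≤ (_Below_.above s p (κ-∈ p)))
    lower-cut-in s {p} aK (inj₂ K≺κp) = Equivalence.from (lower-cut-⇔ s (point p)) λ h<β → point-line {p} aK λ (y , h) →
      ordered K≺κp h (hull-point (κ-∈ p)) λ y<Yp → hull-above s h
        (≤-trans (height-mono (_Below_.α s) ≈-refl (<⇒≤ y<Yp)) (<⇒≤ h<β))

    lower-cut-out : ∀ {K U} (s : U ≺ K) {p} → Active (ρ p) U → U ≡ κ p ⊎ κ p ≺ U → ¬ HalfPlane (lower-cut s) (point p)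
    lower-cut-out s {p} aU (inj₁ refl) p∈ = Equivalence.to (lower-cut-⇔ s (point p)) p∈ (_Below_.below s p (κ-∈ p))
    lower-cut-out s {p} aU (inj₂ κp≺U) p∈ = point-line {p} aU λ (y , h) →
      ordered κp≺U (hull-point (κ-∈ p)) h λ Yp<y → hull-below s h
        (≤-trans (Equivalence.to (lower-cut-⇔ s (point p)) p∈) (height-mono (_Below_.α s) ≈-refl (<⇒≤ Yp<y)))

    module Upward = OneSide _≺_ Below? ≺-asym ≺-trans ≺-connected upper-cut upper-cut-in upper-cut-out

    module Downward = OneSide (flip _≺_) (flip Below?) (λ aK aL → ≺-asym aL aK)
      (λ aK aL aN L≺K N≺L → ≺-trans aN aL aK N≺L L≺K) (swap ∘ ≺-connected) lower-cut lower-cut-in lower-cut-out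

    -- Weights of the parts.

    private
      inPart strip lowPart highPart : Fin M → Fin n → Bool
      inPart   K p = does (κ p ≟ K)
      strip    K p = within K (ℕ.suc (r K)) p
      lowPart  K p = strip K p ∧ Upward.low K p
      highPart K p = strip K p ∧ Downward.low K p

    strip-active : ∀ {K p} → Active (ρ p) K → strip K p ≡ true
    strip-active {K} {p} (l≤ρ , ρ≤r) = cong₂ _∧_ (dec-true (l K ℕₚ.≤? ρ p) l≤ρ) (dec-true (ρ p ℕₚ.<? ℕ.suc (r K)) (s≤s ρ≤r))

    strip-inactive : ∀ {K p} → ¬ Active (ρ p) K → strip K p ≡ false
    strip-inactive {K} {p} ¬active with l K ℕₚ.≤? ρ p
    ... | no  l≰ρ = cong (_∧ does (ρ p ℕₚ.<? ℕ.suc (r K))) (dec-false (l K ℕₚ.≤? ρ p) l≰ρ)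
    ... | yes l≤ρ = cong₂ _∧_ (dec-true (l K ℕₚ.≤? ρ p) l≤ρ)
      (dec-false (ρ p ℕₚ.<? ℕ.suc (r K)) λ ρ<1+r → ¬active (l≤ρ , ℕₚ.≤-pred ρ<1+r))

    -- Each point of the strip lies in `K`, in a part below `K` or in a part above it. The points of
    -- `K` are counted in both `lowPart` and `highPart`, which the term for `inPart` balances.
    part-decomposition : ∀ K p → χ (inPart K p) ℤ.+ χ (strip K p) ≡ χ (lowPart K p) ℤ.+ χ (highPart K p)
    part-decomposition K p with κ p ≟ K
    ... | yes refl rewrite strip-active {κ p} {p} (κ-active p) = refl
    ... | no κp≢K with (l K ℕₚ.≤? ρ p) ×-dec (ρ p ℕₚ.≤? r K)
    ...   | no ¬active rewrite strip-inactive {K} {p} ¬active = refl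
    ...   | yes active rewrite strip-active {K} {p} active with Below? (κ p) K | Below? K (κ p)
    ...     | yes _    | no _     = refl
    ...     | no _     | yes _    = refl
    ...     | yes κp≺K | yes K≺κp = contradiction K≺κp (≺-asym (κ-active p) active κp≺K)
    ...     | no κp⊀K  | no K⊀κp  = ⊥-elim ([ κp⊀K , K⊀κp ]′ (≺-connected κp≢K))

    -- The strip is the difference of two nested sets of initial columns; the constant `false` fills
    -- the fourth place of `weight-+`.
    strip-decomposition : ∀ K p → χ (strip K p) ℤ.+ χ (below (l K) p) ≡ χ (below (ℕ.suc (r K)) p) ℤ.+ χ false
    strip-decomposition K p with ℕₚ.<-≤-connex (ρ p) (l K)
    ... | inj₁ ρ<l rewrite dec-false (l K ℕₚ.≤? ρ p) (ℕₚ.<⇒≱ ρ<l) | dec-true (ρ p ℕₚ.<? l K) ρ<l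
                         | dec-true (ρ p ℕₚ.<? ℕ.suc (r K)) (ℕₚ.m<n⇒m<1+n (ℕₚ.<-≤-trans ρ<l (l≤r K))) = refl
    ... | inj₂ l≤ρ rewrite dec-true (l K ℕₚ.≤? ρ p) l≤ρ | dec-false (ρ p ℕₚ.<? l K) (ℕₚ.≤⇒≯ l≤ρ) = refl

    strip-bound : ∀ K → ℤ.∣ weight ω (strip K) ∣ ℕ.≤ D ℕ.+ D
    strip-bound K = begin
      ℤ.∣ weight ω (strip K) ∣ ≡⟨ cong ℤ.∣_∣ (transpose (weight ω (strip K)) (weight ω (below (l K))) (weight ω (below (ℕ.suc (r K))))
        (≡.trans (weight-+ ω (strip K) (below (l K)) (below (ℕ.suc (r K))) (λ _ → false) (strip-decomposition K))
          (≡.trans (cong (λ x → weight ω (below (ℕ.suc (r K))) ℤ.+ x) (weight-∅ ω)) (ℤₚ.+-identityʳ (weight ω (below (ℕ.suc (r K)))))))) ⟩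
      ℤ.∣ weight ω (below (ℕ.suc (r K))) ℤ.- weight ω (below (l K)) ∣
        ≤⟨ ℤₚ.∣i-j∣≤∣i∣+∣j∣ (weight ω (below (ℕ.suc (r K)))) (weight ω (below (l K))) ⟩
      _ ≤⟨ ℕₚ.+-mono-≤ (below-bound (ℕ.suc (r K))) (below-bound (l K)) ⟩
      D ℕ.+ D ∎
      where
      open ℕₚ.≤-Reasoning

    disc-part : ∀ K → disc S (Z K) ≡ ℤ.∣ weight ω (inPart K) ∣
    disc-part K = ≡.trans (disc≡∣weight∣ (Z K)) (cong ℤ.∣_∣ (weight-cong ω member))
      where
      member : ∀ p → lookup (Z K) p ≡ inPart K p
      member p with κ p ≟ K
      ... | yes refl = []=⇒lookup (κ-∈ p)
      ... | no κp≢K with lookup (Z K) p in eq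
      ...   | true  = contradiction (κ-unique (lookup⇒[]= p (Z K) eq)) κp≢K
      ...   | false = refl

    disc-part-≤ : ∀ K → disc S (Z K) ℕ.≤ ℤ.∣ weight ω (lowPart K) ∣ ℕ.+ ℤ.∣ weight ω (highPart K) ∣ ℕ.+ (D ℕ.+ D)
    disc-part-≤ K = begin
      disc S (Z K) ≡⟨ disc-part K ⟩
      ℤ.∣ weight ω (inPart K) ∣ ≡⟨ cong ℤ.∣_∣ (transpose (weight ω (inPart K)) (weight ω (strip K)) _
        (weight-+ ω (inPart K) (strip K) (lowPart K) (highPart K) (part-decomposition K))) ⟩
      ℤ.∣ weight ω (lowPart K) ℤ.+ weight ω (highPart K) ℤ.- weight ω (strip K) ∣
        ≤⟨ ℤₚ.∣i-j∣≤∣i∣+∣j∣ (weight ω (lowPart K) ℤ.+ weight ω (highPart K)) (weight ω (strip K)) ⟩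
      _ ≤⟨ ℕₚ.+-mono-≤ (ℤₚ.∣i+j∣≤∣i∣+∣j∣ (weight ω (lowPart K)) (weight ω (highPart K))) (strip-bound K) ⟩
      ℤ.∣ weight ω (lowPart K) ∣ ℕ.+ ℤ.∣ weight ω (highPart K) ∣ ℕ.+ (D ℕ.+ D) ∎
      where
      open ℕₚ.≤-Reasoning

    discΠ-bound : sumℕ (λ K → ℤ.∣ weight ω (lowPart K) ∣) ℕ.≤ 6 ℕ.* D ℕ.* M →
                  sumℕ (λ K → ℤ.∣ weight ω (highPart K) ∣) ℕ.≤ 6 ℕ.* D ℕ.* M →
                  discΠ S Π ℕ.≤ 14 ℕ.* D
    discΠ-bound low-bound high-bound = ℕₚ.*-cancelˡ-≤ M (begin
      M ℕ.* discΠ S Π                     ≡⟨ sum-const M (discΠ S Π) ⟨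
      sumℕ {M} (λ _ → discΠ S Π)          ≤⟨ sum-mono-≤ (λ K → foldr₁-⊓-≤ (disc S) parts K) ⟩
      sumℕ (λ K → disc S (Z K))           ≤⟨ sum-mono-≤ disc-part-≤ ⟩
      sumℕ (λ K → low K ℕ.+ high K ℕ.+ (D ℕ.+ D))
        ≡⟨ ≡.trans (∑ℕ-distrib-+ (λ K → low K ℕ.+ high K) (λ _ → D ℕ.+ D))
             (cong₂ ℕ._+_ (∑ℕ-distrib-+ low high) (sum-const M (D ℕ.+ D))) ⟩
      sumℕ low ℕ.+ sumℕ high ℕ.+ M ℕ.* (D ℕ.+ D)
        ≤⟨ ℕₚ.+-monoˡ-≤ (M ℕ.* (D ℕ.+ D)) (ℕₚ.+-mono-≤ low-bound high-bound) ⟩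
      -- Each sweep direction contributes `6 * D * M`, and each part contributes `D + D` for its
      -- strip.
      6 ℕ.* D ℕ.* M ℕ.+ 6 ℕ.* D ℕ.* M ℕ.+ M ℕ.* (D ℕ.+ D) ≡⟨ arith D M ⟩
      M ℕ.* (14 ℕ.* D)                    ∎)
      where
      open ℕₚ.≤-Reasoning
      low high : Fin M → ℕ
      low  K = ℤ.∣ weight ω (lowPart K) ∣
      high K = ℤ.∣ weight ω (highPart K) ∣
      arith : ∀ D M → 6 ℕ.* D ℕ.* M ℕ.+ 6 ℕ.* D ℕ.* M ℕ.+ M ℕ.* (D ℕ.+ D) ≡ M ℕ.* (14 ℕ.* D)
      arith = ℕ-Solver.solve-∀

  discΠ≤14D : discΠ S Π ℕ.≤ 14 ℕ.* D
  discΠ≤14D = decidable-stable (_ ℕₚ.≤? _) (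
    ¬¬-∀ (λ p → ¬¬-∀ λ q → ¬¬-excluded-middle {A = X p < X q}) >>= λ X<? →
    ¬¬-∀ (λ K → ¬¬-∀ λ L → ¬¬-excluded-middle {A = Z K Below Z L}) >>= λ Below? →
    let open Sweeping X<? Below? in
    Upward.half >>= λ low-bound → Downward.half >>= λ high-bound →
    return (discΠ-bound low-bound high-bound))

-- Fractions and the final estimates.

open import Data.Integer.Base using (+_)
open import Data.Nat.Base using (NonZero)
open import Data.Rational.Base using (_/_; _-_; _⊔_; _≤_)
import Data.Rational.Base as ℚ
import Data.Rational.Properties as ℚₚ
open import Data.Rational.Unnormalised.Base as ℚᵘ using (mkℚᵘ; *≤*)
import Data.Rational.Unnormalised.Properties as ℚᵘₚ

fromℚᵘ-mono-≤ : ∀ {p q} → p ℚᵘ.≤ q → ℚ.fromℚᵘ p ≤ ℚ.fromℚᵘ q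
fromℚᵘ-mono-≤ {p} {q} p≤q = ℚₚ.toℚᵘ-cancel-≤ (begin
  ℚ.toℚᵘ (ℚ.fromℚᵘ p) ≃⟨ ℚₚ.toℚᵘ-fromℚᵘ p ⟩
  p                   ≤⟨ p≤q ⟩
  q                   ≃⟨ ℚₚ.toℚᵘ-fromℚᵘ q ⟨
  ℚ.toℚᵘ (ℚ.fromℚᵘ q) ∎)
  where open ℚᵘₚ.≤-Reasoning

/-mono-≤ : ∀ m a n b → m ℕ.* ℕ.suc b ℕ.≤ n ℕ.* ℕ.suc a → + m / ℕ.suc a ≤ + n / ℕ.suc b
/-mono-≤ m a n b m*b≤n*a = fromℚᵘ-mono-≤ {mkℚᵘ (+ m) a} {mkℚᵘ (+ n) b} (*≤* (begin
  + m ℤ.* + ℕ.suc b     ≡⟨ ℤₚ.pos-* m (ℕ.suc b) ⟨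
  + (m ℕ.* ℕ.suc b)     ≤⟨ ℤ.+≤+ m*b≤n*a ⟩
  + (n ℕ.* ℕ.suc a)     ≡⟨ ℤₚ.pos-* n (ℕ.suc a) ⟩
  + n ℤ.* + ℕ.suc a     ∎))
  where open ℤₚ.≤-Reasoning

/1-homo-+ : ∀ m n → + (m ℕ.+ n) / 1 ≡ + m / 1 ℚ.+ + n / 1
/1-homo-+ m n = ℚₚ.toℚᵘ-injective (begin-equality
  ℚ.toℚᵘ (+ (m ℕ.+ n) / 1)                   ≃⟨ ℚₚ.toℚᵘ-fromℚᵘ (mkℚᵘ (+ (m ℕ.+ n)) 0) ⟩
  mkℚᵘ (+ (m ℕ.+ n)) 0                       ≡⟨ cong (λ i → mkℚᵘ i 0) (≡.sym (cong₂ ℤ._+_ (ℤₚ.*-identityʳ (+ m)) (ℤₚ.*-identityʳ (+ n)))) ⟩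
  mkℚᵘ (+ m) 0 ℚᵘ.+ mkℚᵘ (+ n) 0             ≃⟨ ℚᵘₚ.+-cong (ℚₚ.toℚᵘ-fromℚᵘ (mkℚᵘ (+ m) 0)) (ℚₚ.toℚᵘ-fromℚᵘ (mkℚᵘ (+ n) 0)) ⟨
  ℚ.toℚᵘ (+ m / 1) ℚᵘ.+ ℚ.toℚᵘ (+ n / 1)     ≃⟨ ℚₚ.toℚᵘ-homo-+ (+ m / 1) (+ n / 1) ⟨
  ℚ.toℚᵘ (+ m / 1 ℚ.+ + n / 1)               ∎)
  where open ℚᵘₚ.≤-Reasoning

p≤q+r⇒p-r≤q : ∀ {p q} r → p ≤ q ℚ.+ r → p - r ≤ q
p≤q+r⇒p-r≤q {p} {q} r p≤q+r = begin
  p - r             ≤⟨ ℚₚ.+-monoˡ-≤ (ℚ.- r) p≤q+r ⟩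
  q ℚ.+ r - r       ≡⟨ ℚₚ.+-assoc q r (ℚ.- r) ⟩
  q ℚ.+ (r - r)     ≡⟨ cong (q ℚ.+_) (ℚₚ.+-inverseʳ r) ⟩
  q ℚ.+ ℚ.0ℚ        ≡⟨ ℚₚ.+-identityʳ q ⟩
  q                 ∎
  where open ℚₚ.≤-Reasoning

theorem14 : (𝓡 : RealNumbers) → let open Plane 𝓡 in
    ∀ (n : ℕ) .{{_ : NonZero n}} (S : ColouredPointSet n) → GeneralPosition S →
    ∀ (c d₂ : ℕ) → IsCoarseness S c → IsMaxSeparableDisc S 2 d₂ →
    ((+ c / 128) ⊔ (+ c / 64 - imbalance S) ≤ (+ d₂ / 8) ⊔ (+ d₂ / 4 - imbalance S))
    ×
    ((+ d₂ / 8) ⊔ (+ d₂ / 4 - imbalance S) ≤ + c / 1)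
theorem14 𝓡 n S _ c d₂ ((Π , refl) , partition-max) ((I , refl) , island-max) =
  ℚₚ.⊔-mono-≤
    -- `/-mono-≤` takes predecessors of denominators: 127 and 7 stand for 128 and 8.
    (/-mono-≤ c 127 d₂ 7 (begin
      c ℕ.* 8               ≤⟨ ℕₚ.*-monoˡ-≤ 8 c≤16d ⟩
      16 ℕ.* d₂ ℕ.* 8       ≡⟨ 16d*8≡d*128 d₂ ⟩
      d₂ ℕ.* 128            ∎))
    (ℚₚ.+-monoˡ-≤ (ℚ.- Plane.imbalance 𝓡 S) (/-mono-≤ c 63 d₂ 3 (begin
      c ℕ.* 4               ≤⟨ ℕₚ.*-monoˡ-≤ 4 c≤16d ⟩
      16 ℕ.* d₂ ℕ.* 4       ≡⟨ 16d*4≡d*64 d₂ ⟩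
      d₂ ℕ.* 64             ∎))) ,
  ℚₚ.⊔-lub
    (/-mono-≤ d₂ 7 c 0 (begin
      d₂ ℕ.* 1              ≡⟨ ℕₚ.*-identityʳ d₂ ⟩
      d₂                    ≤⟨ d≤ ⟩
      4 ℕ.* (c ℕ.+ i)       ≤⟨ ℕₚ.*-monoʳ-≤ 4 (ℕₚ.+-monoʳ-≤ c i≤c) ⟩
      4 ℕ.* (c ℕ.+ c)       ≡⟨ 4[c+c]≡c*8 c ⟩
      c ℕ.* 8               ∎))
    (p≤q+r⇒p-r≤q (Plane.imbalance 𝓡 S) (≡.subst (+ d₂ / 4 ≤_) (/1-homo-+ c i) (/-mono-≤ d₂ 3 (c ℕ.+ i) 0 (begin
      d₂ ℕ.* 1              ≡⟨ ℕₚ.*-identityʳ d₂ ⟩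
      d₂                    ≤⟨ d≤ ⟩
      4 ℕ.* (c ℕ.+ i)       ≡⟨ ℕₚ.*-comm 4 (c ℕ.+ i) ⟩
      (c ℕ.+ i) ℕ.* 4       ∎))))
  where
  open ℕₚ.≤-Reasoning
  i = ℕ.∣ ∣ Plane.ColouredPointSet.R S ∣ - ∣ Plane.ColouredPointSet.B S ∣ ∣
  i≤c : i ℕ.≤ c
  i≤c = UpperBound.imbalance≤ 𝓡 S partition-max
  d≤ : d₂ ℕ.≤ 4 ℕ.* (c ℕ.+ i)
  d≤ = UpperBound.separable-light 𝓡 S partition-max I
  c≤16d : c ℕ.≤ 16 ℕ.* d₂
  -- The constant 14 is relaxed to 16, the common ratio of 128 to 8 and of 64 to 4.
  c≤16d = ℕₚ.≤-trans (LowerBound.discΠ≤14D 𝓡 S Π island-max) (ℕₚ.*-monoˡ-≤ d₂ (ℕₚ.m≤m+n 14 2))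
  16d*8≡d*128 : ∀ d → 16 ℕ.* d ℕ.* 8 ≡ d ℕ.* 128
  16d*8≡d*128 = ℕ-Solver.solve-∀
  16d*4≡d*64 : ∀ d → 16 ℕ.* d ℕ.* 4 ≡ d ℕ.* 64
  16d*4≡d*64 = ℕ-Solver.solve-∀
  4[c+c]≡c*8 : ∀ c → 4 ℕ.* (c ℕ.+ c) ≡ c ℕ.* 8
  4[c+c]≡c*8 = ℕ-Solver.solve-∀
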